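{- Let $K\subsetneq L$ be a field extension and let $A,B\subseteq L$ be $n$-dimensional $K$-subspaces with $0 < n < \infty$ and $1\notin B$. Let $\ell\ge 0$ be an integer. Then $\delta(A,B)>\ell$ if and only if there exists a nonzero $K$-subspace $R\subseteq B$ such that $A$ and $B$ admit decompositions into $K$-subspaces $$A = S \oplus Y,\qquad B = R \oplus Z,$$ where $\dim Y<\dim R -\ell$ and $$S=\bigoplus_{i=1}^m a_iK(R)$$ for some $a_1, \ldots ,a_m \in S$.
   Context: Fields are commutative. All dimensions are over $K$ unless indicated otherwise. All direct sums are internal. $[n]=\{1,\dots,n\}$, and $\langle X\rangle$ denotes the $K$-span of a set $X$. For a subset $R\subseteq L$, $K(R)$ is the smallest subfield of $L$ containing $K\cup R$. Definition (partial matching of bases). Let $A,B$ be $n$-dimensional $K$-subspaces of $L$, $n\ge 1$, and $0\le d\le n$ an integer. An ordered basis $\mathcal{A}=\{a_1,\dots,a_n\}$ of $A$ is partially matched to an ordered basis $\mathcal{B}=\{b_1,\dots,b_n\}$ of $B$ with defect $d$ if there exists $P\subseteq[n]$ with $|P|=n-d$ such that $$a_i^{ -1}A\cap B\subseteq \langle b_1,\dots,b_{i-1},b_{i+1},\dots,b_n\rangle\quad\text{for each } i\in P.$$ Definition (partial matching of subspaces). $A$ is partially matched to $B$ with defect $d$ if for every ordered basis $\mathcal{A}$ of $A$ there exists an ordered basis $\mathcal{B}$ of $B$ such that $\mathcal{A}$ is partially matched to $\mathcal{B}$ with defect $d$. Definition (deficiency). For $n$-dimensional $A,B$ with $0<n<\infty$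 and $1\notin B$, $\delta(A,B)$ is the least nonnegative integer $d$ for which $A$ is partially matched to $B$ with defect $d$. -}

module Defs where

open import Algebra.Apartness.Bundles using (HeytingField; HeytingCommutativeRing)
open import Algebra.Bundles using (CommutativeMonoid; CommutativeRing)
import Algebra.Properties.CommutativeMonoid.Sum as CMSum
open import Axiom.ExcludedMiddle using (ExcludedMiddle)
open import Data.Fin.Base using (Fin)
import Data.Fin.Subset as FS
import Data.Fin.Subset.Properties as FSP
open import Data.Nat.Base using (ℕ; _∸_; _≤_; _<_)
import Data.Nat.Properties as ℕP
open import Data.Nat.Induction using (<-rec)
open import Data.Product.Base using (Σ-syntax; ∃; ∃-syntax; _×_; _,_; proj₁)
open import Data.Vec.Functional using (Vector)
open import Level using (_⊔_) renaming (suc to lsuc)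
open import Relation.Binary.PropositionalEquality.Core using (_≡_; _≢_; subst; sym)
open import Relation.Nullary using (¬_; yes; no; contradiction)
open import Relation.Unary using (Pred; _∈_; _∉_; _⊆_; _∩_)

IsLeast : ∀ {a} → (ℕ → Set a) → ℕ → Set a
IsLeast P d = P d × (∀ d′ → P d′ → d ≤ d′)

least : ∀ {a} → ExcludedMiddle a → (P : ℕ → Set a) → ∀ n → P n → ∃ (IsLeast P)
least {a} em P = <-rec (λ n → P n → ∃ (IsLeast P)) step
  where
  step : ∀ n → (∀ {m} → m < n → P m → ∃ (IsLeast P)) → P n → ∃ (IsLeast P)
  step n rec pn with em {P = ∃[ m ] (m < n × P m)}
  ... | yes (m , m<n , pm) = rec m<n pm
  ... | no  none           = n , pn , λ d pd → ℕP.≮⇒≥ (λ d<n → none (d , d<n , pd))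

-- Under excluded middle the apartness of a `HeytingField` is equivalent to
-- `¬ (x ≈ y)`, so that every nonzero element is invertible: `HeytingField`s are
-- then exactly the commutative fields of classical algebra.

module Subfields {c ℓ₁ ℓ₂} (L : HeytingField c ℓ₁ ℓ₂) where

  open HeytingField L using (Carrier; _≈_; _+_; _*_; -_; 0#; 1#)

  SubsetOf : Set (lsuc (c ⊔ ℓ₁ ⊔ ℓ₂))
  SubsetOf = Pred Carrier (c ⊔ ℓ₁ ⊔ ℓ₂)

  record Subfield : Set (lsuc (c ⊔ ℓ₁ ⊔ ℓ₂)) where
    field
      set        : SubsetOf
      resp       : ∀ {x y} → x ≈ y → x ∈ set → y ∈ set
      0∈         : 0# ∈ set
      1∈         : 1# ∈ set
      +-closed   : ∀ {x y} → x ∈ set → y ∈ set → x + y ∈ set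
      neg-closed : ∀ {x} → x ∈ set → - x ∈ set
      *-closed   : ∀ {x y} → x ∈ set → y ∈ set → x * y ∈ set
      inv-closed : ∀ {x y} → x ∈ set → x * y ≈ 1# → y ∈ set

open Subfields public

module FieldExtension {c ℓ₁ ℓ₂} {L : HeytingField c ℓ₁ ℓ₂} where

  open HeytingField L using (Carrier; _≈_; _+_; _*_; -_; 0#; 1#)

  IsProper : Subfield L → Set (c ⊔ ℓ₁ ⊔ ℓ₂)
  IsProper K = ∃[ x ] x ∉ Subfield.set K

  data Adjoin (K : Subfield L) (R : SubsetOf L) : SubsetOf L where
    base : ∀ {x} → x ∈ Subfield.set K → Adjoin K R x
    gen  : ∀ {x} → x ∈ R → Adjoin K R x
    ≈-closed : ∀ {x y} → x ≈ y → Adjoin K R x → Adjoin K R y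
    add  : ∀ {x y} → Adjoin K R x → Adjoin K R y → Adjoin K R (x + y)
    neg  : ∀ {x} → Adjoin K R x → Adjoin K R (- x)
    mul  : ∀ {x y} → Adjoin K R x → Adjoin K R y → Adjoin K R (x * y)
    inv  : ∀ {x y} → Adjoin K R x → x * y ≈ 1# → Adjoin K R y

  -- K ⟮ R ⟯ is the subfield K(R).
  infix 9 _⟮_⟯
  _⟮_⟯ : Subfield L → SubsetOf L → Subfield L
  K ⟮ R ⟯ = record
    { set        = Adjoin K R
    ; resp       = ≈-closed
    ; 0∈         = base (Subfield.0∈ K)
    ; 1∈         = base (Subfield.1∈ K)
    ; +-closed   = add
    ; neg-closed = neg
    ; *-closed   = mul
    ; inv-closed = inv
    }

  ⟮⟯-smallest : ∀ {K R} (F : Subfield L) → Subfield.set K ⊆ Subfield.set F →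
                R ⊆ Subfield.set F → Subfield.set (K ⟮ R ⟯) ⊆ Subfield.set F
  ⟮⟯-smallest {K} {R} F K⊆F R⊆F = go
    where
    module F = Subfield F
    go : Adjoin K R ⊆ F.set
    go (base x∈K)   = K⊆F x∈K
    go (gen x∈R)    = R⊆F x∈R
    go (≈-closed x≈y u) = F.resp x≈y (go u)
    go (add u v)    = F.+-closed (go u) (go v)
    go (neg u)      = F.neg-closed (go u)
    go (mul u v)    = F.*-closed (go u) (go v)
    go (inv u xy≈1) = F.inv-closed (go u) xy≈1

  infixr 8 _∙_
  _∙_ : Carrier → Subfield L → SubsetOf L
  (a ∙ F) x = ∃[ u ] (u ∈ Subfield.set F × x ≈ a * u)

open FieldExtension public

module Subspaces {c ℓ₁ ℓ₂} {L : HeytingField c ℓ₁ ℓ₂} (K : Subfield L) where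

  open HeytingField L using (Carrier; _≈_; _+_; _*_; 0#)

  record Subspace : Set (lsuc (c ⊔ ℓ₁ ⊔ ℓ₂)) where
    field
      set      : SubsetOf L
      resp     : ∀ {x y} → x ≈ y → x ∈ set → y ∈ set
      0∈       : 0# ∈ set
      +-closed : ∀ {x y} → x ∈ set → y ∈ set → x + y ∈ set
      *-closed : ∀ {k x} → k ∈ Subfield.set K → x ∈ set → k * x ∈ set

open Subspaces public

module LinearAlgebra {c ℓ₁ ℓ₂} {L : HeytingField c ℓ₁ ℓ₂} {K : Subfield L} where

  open HeytingField L using (Carrier; _≈_; _+_; _*_; 0#; 1#; heytingCommutativeRing)

  +-monoid : CommutativeMonoid c ℓ₁
  +-monoid = CommutativeRing.+-commutativeMonoid
    (HeytingCommutativeRing.commutativeRing heytingCommutativeRing)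

  open CMSum +-monoid using (sum)

  infix 4 _∈ᵥ_ _⊆ᵥ_
  _∈ᵥ_ : Carrier → Subspace K → Set (c ⊔ ℓ₁ ⊔ ℓ₂)
  x ∈ᵥ V = x ∈ Subspace.set V

  _⊆ᵥ_ : Subspace K → Subspace K → Set (c ⊔ ℓ₁ ⊔ ℓ₂)
  V ⊆ᵥ W = Subspace.set V ⊆ Subspace.set W

  IsNonzero : Subspace K → Set (c ⊔ ℓ₁ ⊔ ℓ₂)
  IsNonzero V = ∃[ x ] (x ∈ᵥ V × ¬ (x ≈ 0#))

  IsCombination : ∀ {m} → Vector Carrier m → Carrier → Set (c ⊔ ℓ₁ ⊔ ℓ₂)
  IsCombination {m} v x =
    Σ[ k ∈ Vector Carrier m ] ((∀ i → k i ∈ Subfield.set K) × x ≈ sum (λ i → k i * v i))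

  ⟨_⟩ : ∀ {q} → Pred Carrier q → Pred Carrier (c ⊔ ℓ₁ ⊔ ℓ₂ ⊔ q)
  ⟨ X ⟩ x = Σ[ m ∈ ℕ ] ∃[ v ] ((∀ (i : Fin m) → v i ∈ X) × IsCombination v x)

  record IsBasis (V : Subspace K) {n : ℕ} (v : Vector Carrier n) : Set (c ⊔ ℓ₁ ⊔ ℓ₂) where
    field
      members     : ∀ i → v i ∈ᵥ V
      spans       : ∀ {x} → x ∈ᵥ V → IsCombination v x
      independent : ∀ (k : Vector Carrier n) → (∀ i → k i ∈ Subfield.set K) →
                    sum (λ i → k i * v i) ≈ 0# → ∀ i → k i ≈ 0#

  HasDim : Subspace K → ℕ → Set (c ⊔ ℓ₁ ⊔ ℓ₂)
  HasDim V n = ∃[ v ] IsBasis V {n} v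

  -- Dimensions are natural numbers here; since dim Y ≥ 0, truncated subtraction
  -- on the right-hand side agrees with subtraction of integers.
  dim_<dim_-_ : Subspace K → Subspace K → ℕ → Set (c ⊔ ℓ₁ ⊔ ℓ₂)
  dim Y <dim R - ℓ = ∃[ y ] ∃[ r ] (HasDim Y y × HasDim R r × y < r ∸ ℓ)

  infix 4 _≐_⊕_ _≐⨁_
  record _≐_⊕_ (V S Y : Subspace K) : Set (c ⊔ ℓ₁ ⊔ ℓ₂) where
    field
      contains : ∀ {s y} → s ∈ᵥ S → y ∈ᵥ Y → s + y ∈ᵥ V
      spans    : ∀ {x} → x ∈ᵥ V → ∃[ s ] ∃[ y ] (s ∈ᵥ S × y ∈ᵥ Y × x ≈ s + y)
      disjoint : ∀ {x} → x ∈ᵥ S → x ∈ᵥ Y → x ≈ 0#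

  record _≐⨁_ (V : Subspace K) {m : ℕ} (U : Fin m → SubsetOf L) : Set (c ⊔ ℓ₁ ⊔ ℓ₂) where
    field
      contains    : ∀ (u : Vector Carrier m) → (∀ i → u i ∈ U i) → sum u ∈ᵥ V
      spans       : ∀ {x} → x ∈ᵥ V → ∃[ u ] ((∀ i → u i ∈ U i) × x ≈ sum u)
      independent : ∀ (u : Vector Carrier m) → (∀ i → u i ∈ U i) →
                    sum u ≈ 0# → ∀ i → u i ≈ 0#

  -- The subset a⁻¹V.  It is empty for a ≈ 0#, but a is always a member of a basis.
  infixr 8 _⁻¹∙_
  _⁻¹∙_ : Carrier → Subspace K → SubsetOf L
  (a ⁻¹∙ V) x = ∃[ a⁻¹ ] (a * a⁻¹ ≈ 1# × ∃[ v ] (v ∈ᵥ V × x ≈ a⁻¹ * v))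

  -- { b j ∣ j ≠ i }
  omit : ∀ {n} → Vector Carrier n → Fin n → Pred Carrier ℓ₁
  omit b i x = ∃[ j ] (j ≢ i × x ≈ b j)

  BasisPartiallyMatched : (A B : Subspace K) {n : ℕ} (a b : Vector Carrier n) →
                          ℕ → Set (c ⊔ ℓ₁ ⊔ ℓ₂)
  BasisPartiallyMatched A B {n} a b d =
    Σ[ P ∈ FS.Subset n ] (FS.∣ P ∣ ≡ n ∸ d ×
      (∀ i → i FS.∈ P → (a i ⁻¹∙ A) ∩ Subspace.set B ⊆ ⟨ omit b i ⟩))

  PartiallyMatched : (A B : Subspace K) (n d : ℕ) → Set (c ⊔ ℓ₁ ⊔ ℓ₂)
  PartiallyMatched A B n d = d ≤ n ×
    (∀ (a : Vector Carrier n) → IsBasis A a →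
     ∃[ b ] (IsBasis B {n} b × BasisPartiallyMatched A B a b d))

  -- Defect n is always possible, with P = ∅.
  PartiallyMatched-n : ∀ {A B n} → HasDim B n → PartiallyMatched A B n n
  PartiallyMatched-n {n = n} (b , b-basis) = ℕP.≤-refl , λ a _ →
    b , b-basis , FS.⊥
      , subst (FS.∣ FS.⊥ {n} ∣ ≡_) (sym (ℕP.n∸n≡0 n)) (FSP.∣⊥∣≡0 n)
      , λ i i∈⊥ → contradiction i∈⊥ FSP.∉⊥

  deficiency : ExcludedMiddle (c ⊔ ℓ₁ ⊔ ℓ₂) → ∀ A B {n} → HasDim A n → HasDim B n →
               ∃ (IsLeast (PartiallyMatched A B n))
  deficiency em A B {n} _ dimB =
    least em (PartiallyMatched A B n) n (PartiallyMatched-n {A} {B} dimB)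

  δ : ExcludedMiddle (c ⊔ ℓ₁ ⊔ ℓ₂) → ∀ A B {n} → HasDim A n → HasDim B n → ℕ
  δ em A B dimA dimB = proj₁ (deficiency em A B dimA dimB)

open LinearAlgebra public

{-# OPTIONS --safe #-}

-- If S = ⊕ aᵢK(R) ⊆ A, then SR ⊆ A; for a basis of A extending one of S, the matching conditions
-- indexed by P and by the basis of S confine R to the span of few bⱼ, so dim R ≤ δ + dim Y.
-- Conversely, if the basis a cannot be matched with defect ℓ, Rado's theorem with defect gives a set J
-- with dim ⋂_{j ∈ J} (aⱼ⁻¹A ∩ B) > n − |J| + ℓ, that is, subspaces T ⊆ A and R ⊆ B with TR ⊆ A and
-- dim T + dim R > n + ℓ.  The Dyson transforms (T, R) ↦ (T + eR, R ∩ e⁻¹T), e ∈ T, preserve these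
-- properties and shrink R until TR ⊆ T.  Then T is a vector space over K(R), and S = T works.

module Submission where

open import Defs
open import Algebra.Apartness.Bundles using (HeytingField; HeytingCommutativeRing)
import Algebra.Apartness.Properties.HeytingCommutativeRing as HCRProperties
open import Algebra.Bundles using (CommutativeRing)
import Algebra.Properties.CommutativeMonoid.Sum as CMSum
import Algebra.Properties.CommutativeSemigroup as CSProperties
import Algebra.Properties.Ring as RingProperties
import Algebra.Properties.Semiring.Sum as SemiringSum
open import Axiom.ExcludedMiddle using (ExcludedMiddle)
open import Data.Fin.Base using (Fin; zero; suc; punchIn)
open import Data.Fin.Properties using (_≟_; suc-injective; punchIn-punchOut)
import Data.Fin.Subset as FS
import Data.Fin.Subset.Properties as FSP
open import Data.List.Base using (List; []; _∷_; _++_; length; lookup; map; tabulate)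
import Data.List.Membership.Setoid as ListMembership
import Data.List.Membership.Setoid.Properties as ListMembershipProperties
open import Data.List.Properties using (++-assoc; length-++; length-map; length-tabulate; tabulate-lookup)
open import Data.List.Relation.Unary.All as All using (All; []; _∷_)
import Data.List.Relation.Unary.All.Properties as AllP
open import Data.List.Relation.Unary.Any using (here; there)
open import Data.Nat.Base as ℕ using (ℕ; zero; suc; _<_; _>_; _≤_; z≤n; s≤s)
import Data.Nat.Properties as ℕP
import Data.Nat.Solver as ℕSolver
open import Data.Product.Base using (Σ-syntax; ∃; ∃-syntax; _×_; _,_; proj₁; proj₂)
open import Data.Sum.Base using (_⊎_; inj₁; inj₂)
open import Data.Vec.Base using ([]; _∷_; here; there; _[_]≔_)
open import Data.Vec.Functional as Vector using (Vector)
open import Function.Base using (_∘_; case_of_)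
open import Function.Bundles using (_⇔_; mk⇔)
open import Level using (_⊔_)
open import Relation.Binary.PropositionalEquality as ≡ using (_≡_; _≢_)
import Relation.Binary.Reasoning.Setoid as SetoidReasoning
open import Relation.Nullary using (¬_; yes; no; contradiction)
open import Relation.Unary using (Pred; _∈_)

-- For a basis `b` of `B`, the condition `V i ⊆ᵥ omitSpan b i` says that the `i`-th coordinate
-- functional of `b` annihilates `V i`. A matching with defect `ℓ` is thus an independent choice of
-- functionals from `n − ℓ` of the annihilators, which is why a theorem on independent transversals
-- decides it. No dual space is built: a state of the search is a spanning family `b` of `B` with
-- its set `P` of matched labels, and replacing one functional becomes a shear of `b` along one of
-- its vectors. As in an augmenting-path argument, `J` consists of the labels that exchanges from a
-- maximal state can leave unmatched. The vectors of the maximal state at positions outside `P ∩ J`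
-- lie in every `V u` with `u ∈ J`. As `P ∪ J` is everything, their number and `|J|` add up to
-- `2n − |P|`, which exceeds `n + ℓ` exactly when `|P| < n − ℓ`.

m<n∸o⇒m+o<n : ∀ {m} n o → m < n ℕ.∸ o → m ℕ.+ o < n
m<n∸o⇒m+o<n {m} n       zero    m<n = ≡.subst (_< n) (≡.sym (ℕP.+-identityʳ m)) m<n
m<n∸o⇒m+o<n {m} (suc n) (suc o) m<  = ≡.subst (_< suc n) (≡.sym (ℕP.+-suc m o)) (s≤s (m<n∸o⇒m+o<n n o m<))

-- Finite subsets and their cardinalities.

comprehension : (∀ {a} → ExcludedMiddle a) → ∀ {a n} (Q : Fin n → Set a) →
                ∃[ q ] ((∀ {i} → i FS.∈ q → Q i) × (∀ {i} → Q i → i FS.∈ q))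
comprehension em {n = zero}  Q = [] , (λ ()) , λ { {()} }
comprehension em {n = suc n} Q with comprehension em (Q ∘ suc) | em {P = Q zero}
... | q , sound , complete | yes Q₀ = FS.inside ∷ q
    , (λ { here → Q₀ ; (there i∈) → sound i∈ }) , λ { {zero} _ → here ; {suc i} Qᵢ → there (complete Qᵢ) }
... | q , sound , complete | no ¬Q₀ = FS.outside ∷ q
    , (λ { (there i∈) → sound i∈ }) , λ { {zero} Q₀ → contradiction Q₀ ¬Q₀ ; {suc i} Qᵢ → there (complete Qᵢ) }

∣∩∣-cover : ∀ {n} (p q : FS.Subset n) → (∀ {i} → i FS.∉ p → i FS.∈ q) →
            n ℕ.+ FS.∣ p FS.∩ q ∣ ≡ FS.∣ p ∣ ℕ.+ FS.∣ q ∣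
∣∩∣-cover [] [] cover = ≡.refl
∣∩∣-cover {suc n} (s ∷ p) (t ∷ q) cover with ∣∩∣-cover p q (λ i∉ → FSP.drop-there (cover (i∉ ∘ FSP.drop-there)))
∣∩∣-cover {suc n} (FS.inside  ∷ p) (FS.inside  ∷ q) cover | eq = ≡.cong suc
  (≡.trans (ℕP.+-suc n _) (≡.trans (≡.cong suc eq) (≡.sym (ℕP.+-suc FS.∣ p ∣ FS.∣ q ∣))))
∣∩∣-cover {suc n} (FS.inside  ∷ p) (FS.outside ∷ q) cover | eq = ≡.cong suc eq
∣∩∣-cover {suc n} (FS.outside ∷ p) (FS.inside  ∷ q) cover | eq =
  ≡.trans (≡.cong suc eq) (≡.sym (ℕP.+-suc FS.∣ p ∣ FS.∣ q ∣))
∣∩∣-cover {suc n} (FS.outside ∷ p) (FS.outside ∷ q) cover | eq = contradiction (cover {zero} λ ()) λ ()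

∈-insert⁻ : ∀ {n} (p : FS.Subset n) {i u} → i ≢ u → i FS.∈ (p [ u ]≔ FS.inside) → i FS.∈ p
∈-insert⁻ (_ ∷ p) {zero}  {zero}  i≢u i∈         = contradiction ≡.refl i≢u
∈-insert⁻ (_ ∷ p) {zero}  {suc u} i≢u here       = here
∈-insert⁻ (_ ∷ p) {suc i} {zero}  i≢u (there i∈) = there i∈
∈-insert⁻ (_ ∷ p) {suc i} {suc u} i≢u (there i∈) = there (∈-insert⁻ p (i≢u ∘ ≡.cong suc) i∈)

∈-remove⁻ : ∀ {n} (p : FS.Subset n) {i k} → i FS.∈ (p [ k ]≔ FS.outside) → i FS.∈ p
∈-remove⁻ (_ ∷ p) {zero}  {suc k} here       = here
∈-remove⁻ (_ ∷ p) {suc i} {zero}  (there i∈) = there i∈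
∈-remove⁻ (_ ∷ p) {suc i} {suc k} (there i∈) = there (∈-remove⁻ p i∈)

∉-remove : ∀ {n} (p : FS.Subset n) k → k FS.∉ (p [ k ]≔ FS.outside)
∉-remove (_ ∷ p) (suc k) (there k∈) = ∉-remove p k k∈

∣insert∣ : ∀ {n} (p : FS.Subset n) {u} → u FS.∉ p → FS.∣ p [ u ]≔ FS.inside ∣ ≡ suc FS.∣ p ∣
∣insert∣ (FS.inside  ∷ p) {zero}  u∉ = contradiction here u∉
∣insert∣ (FS.outside ∷ p) {zero}  u∉ = ≡.refl
∣insert∣ (FS.inside  ∷ p) {suc u} u∉ = ≡.cong suc (∣insert∣ p (u∉ ∘ there))
∣insert∣ (FS.outside ∷ p) {suc u} u∉ = ∣insert∣ p (u∉ ∘ there)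

∣remove∣ : ∀ {n} (p : FS.Subset n) {k} → k FS.∈ p → suc FS.∣ p [ k ]≔ FS.outside ∣ ≡ FS.∣ p ∣
∣remove∣ (FS.inside  ∷ p) here       = ≡.refl
∣remove∣ (FS.inside  ∷ p) (there k∈) = ≡.cong suc (∣remove∣ p k∈)
∣remove∣ (FS.outside ∷ p) (there k∈) = ∣remove∣ p k∈

∣remove∣-∉ : ∀ {n} (p : FS.Subset n) {k} → k FS.∉ p → FS.∣ p [ k ]≔ FS.outside ∣ ≡ FS.∣ p ∣
∣remove∣-∉ (FS.inside  ∷ p) {zero}  k∉ = contradiction here k∉
∣remove∣-∉ (FS.outside ∷ p) {zero}  k∉ = ≡.refl
∣remove∣-∉ (FS.inside  ∷ p) {suc k} k∉ = ≡.cong suc (∣remove∣-∉ p (k∉ ∘ there))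
∣remove∣-∉ (FS.outside ∷ p) {suc k} k∉ = ∣remove∣-∉ p (k∉ ∘ there)

shrink : ∀ {n} (p : FS.Subset n) {t} → t ≤ FS.∣ p ∣ → ∃[ q ] (q FS.⊆ p × FS.∣ q ∣ ≡ t)
shrink {n} p {zero} _ = FS.⊥ , FSP.⊥⊆ , FSP.∣⊥∣≡0 n
shrink (FS.inside ∷ p) {suc t} (s≤s t≤) with shrink p t≤
... | q , q⊆p , eq = FS.inside ∷ q , FSP.s⊆s q⊆p , ≡.cong suc eq
shrink (FS.outside ∷ p) {suc t} t≤ with shrink p t≤
... | q , q⊆p , eq = FS.outside ∷ q , FSP.s⊆s q⊆p , eq

module Field {c ℓ₁ ℓ₂} (em : ∀ {a} → ExcludedMiddle a) (L : HeytingField c ℓ₁ ℓ₂) where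

  open HeytingField L public
    hiding (zero)
  open HCRProperties heytingCommutativeRing using (x-0≈x; 1#0)

  commutativeRing : CommutativeRing c ℓ₁
  commutativeRing = HeytingCommutativeRing.commutativeRing heytingCommutativeRing

  open CommutativeRing commutativeRing public using (ring)
  open CommutativeRing commutativeRing
    using (semiring; +-commutativeMonoid; +-commutativeSemigroup; *-commutativeSemigroup)
  open RingProperties ring public using (-1*x≈-x; -‿distribˡ-*; -‿distribʳ-*; -‿+-comm)
  open CMSum +-commutativeMonoid public using (sum; sum-cong-≋)
  open SemiringSum semiring public using (*-distribˡ-sum; *-distribʳ-sum)
  open CSProperties +-commutativeSemigroup public using () renaming (interchange to +-interchange)
  open CSProperties *-commutativeSemigroup public using () renaming (x∙yz≈y∙xz to x[yz]≈y[xz])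
  module ≈-Reasoning = SetoidReasoning setoid
  open ListMembership setoid public using () renaming (_∈_ to _∈ˡ_)

  1≉0 : ¬ (1# ≈ 0#)
  1≉0 1≈0 = #-irrefl 1≈0 1#0

  inverse : ∀ {x} → ¬ (x ≈ 0#) → ∃[ y ] x * y ≈ 1#
  inverse {x} x≉0 with em {P = x # 0#}
  ... | no ¬x#0 = contradiction (proj₁ (tight _ _) ¬x#0) x≉0
  ... | yes x#0 with #⇒invertible x#0
  ...   | y , _ , xy≈1 = y , trans (*-congʳ (sym (x-0≈x x))) xy≈1

  [x+y]-y≈x : ∀ x y → (x + y) - y ≈ x
  [x+y]-y≈x x y = trans (+-assoc _ _ _) (trans (+-congˡ (-‿inverseʳ y)) (+-identityʳ x))

  x[yz]≈z : ∀ {x y} z → x * y ≈ 1# → x * (y * z) ≈ z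
  x[yz]≈z z xy≈1 = trans (sym (*-assoc _ _ z)) (trans (*-congʳ xy≈1) (*-identityˡ z))

  k*x+y≈y : ∀ {k x y} → k ≈ 0# → k * x + y ≈ y
  k*x+y≈y {x = x} {y} k≈0 = trans (+-congʳ (trans (*-congʳ k≈0) (zeroˡ x))) (+-identityˡ y)

  -- Spans, independent lists and bases over a subfield.

  module Linear (K : Subfield L) where

    private module K = Subfield K
    open LinearAlgebra {L = L} {K = K} public using ()
      renaming (⟨_⟩ to ⟪_⟫; IsCombination to Combination; omit to Omit)

    infix 4 _∈K
    _∈K : Carrier → Set (c ⊔ ℓ₁ ⊔ ℓ₂)
    k ∈K = Subfield.set K k

    module _ (V : Subspace K) where

      private module V = Subspace V

      neg∈ : ∀ {x} → x ∈ᵥ V → - x ∈ᵥ V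
      neg∈ x∈ = V.resp (-1*x≈-x _) (V.*-closed (K.neg-closed K.1∈) x∈)

      +-cancelʳ∈ : ∀ {x y} → x + y ∈ᵥ V → y ∈ᵥ V → x ∈ᵥ V
      +-cancelʳ∈ x+y∈ y∈ = V.resp ([x+y]-y≈x _ _) (V.+-closed x+y∈ (neg∈ y∈))

      +-cancelˡ∈ : ∀ {x y} → x + y ∈ᵥ V → x ∈ᵥ V → y ∈ᵥ V
      +-cancelˡ∈ x+y∈ x∈ = +-cancelʳ∈ (V.resp (+-comm _ _) x+y∈) x∈

      *-cancelˡ∈ : ∀ {k x} → k ∈K → ¬ (k ≈ 0#) → k * x ∈ᵥ V → x ∈ᵥ V
      *-cancelˡ∈ {k} {x} k∈ k≉0 kx∈ with inverse k≉0
      ... | k′ , kk′≈1 = V.resp (x[yz]≈z x (trans (*-comm k′ k) kk′≈1)) (V.*-closed (K.inv-closed k∈ kk′≈1) kx∈)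

      sum∈ : ∀ {m} {v : Vector Carrier m} → (∀ i → v i ∈ᵥ V) → sum v ∈ᵥ V
      sum∈ {zero}  v∈ = V.0∈
      sum∈ {suc m} v∈ = V.+-closed (v∈ zero) (sum∈ (v∈ ∘ suc))

    module _ {q} (X : Pred Carrier q) where

      ⟪⟫-resp : ∀ {x y} → x ≈ y → ⟪ X ⟫ x → ⟪ X ⟫ y
      ⟪⟫-resp x≈y (m , v , v∈ , k , k∈ , x≈) = m , v , v∈ , k , k∈ , trans (sym x≈y) x≈

      ⟪⟫-0 : ⟪ X ⟫ 0#
      ⟪⟫-0 = 0 , (λ ()) , (λ ()) , (λ ()) , (λ ()) , refl

      ⟪⟫-cons : ∀ {k v y} → k ∈K → X v → ⟪ X ⟫ y → ⟪ X ⟫ (k * v + y)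
      ⟪⟫-cons {k} {v} k∈ v∈ (m , vs , vs∈ , ks , ks∈ , y≈) =
        suc m , (v Vector.∷ vs) , (λ { zero → v∈ ; (suc i) → vs∈ i })
          , (k Vector.∷ ks) , (λ { zero → k∈ ; (suc i) → ks∈ i }) , +-congˡ y≈

      ⟪⟫-gen : ∀ {x} → X x → ⟪ X ⟫ x
      ⟪⟫-gen x∈ = ⟪⟫-resp (trans (+-identityʳ _) (*-identityˡ _)) (⟪⟫-cons K.1∈ x∈ ⟪⟫-0)

      ⟪⟫-+ : ∀ {x y} → ⟪ X ⟫ x → ⟪ X ⟫ y → ⟪ X ⟫ (x + y)
      ⟪⟫-+ {y = y} (m , v , v∈ , k , k∈ , x≈) y∈ = ⟪⟫-resp (+-congʳ (sym x≈)) (go m v v∈ k k∈)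
        where
        go : ∀ m (v : Vector Carrier m) → (∀ i → X (v i)) → (k : Vector Carrier m) → (∀ i → k i ∈K) →
             ⟪ X ⟫ (sum (λ i → k i * v i) + y)
        go zero    v v∈ k k∈ = ⟪⟫-resp (sym (+-identityˡ y)) y∈
        go (suc m) v v∈ k k∈ = ⟪⟫-resp (sym (+-assoc _ _ _))
          (⟪⟫-cons (k∈ zero) (v∈ zero) (go m (v ∘ suc) (v∈ ∘ suc) (k ∘ suc) (k∈ ∘ suc)))

      ⟪⟫-* : ∀ {l x} → l ∈K → ⟪ X ⟫ x → ⟪ X ⟫ (l * x)
      ⟪⟫-* {l} l∈ (m , v , v∈ , k , k∈ , x≈) = m , v , v∈ , (λ i → l * k i) , (λ i → K.*-closed l∈ (k∈ i)) ,
        trans (*-congˡ x≈) (trans (*-distribˡ-sum l (λ i → k i * v i))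
          (sum-cong-≋ (λ i → sym (*-assoc l (k i) (v i)))))

      ⟪⟫-least : (V : Subspace K) → (∀ {x} → X x → x ∈ᵥ V) → ∀ {x} → ⟪ X ⟫ x → x ∈ᵥ V
      ⟪⟫-least V X⊆V (m , v , v∈ , k , k∈ , x≈) =
        Subspace.resp V (sym x≈) (sum∈ V (λ i → Subspace.*-closed V (k∈ i) (X⊆V (v∈ i))))

      combination∈⟪⟫ : ∀ {n} (k v : Vector Carrier n) → (∀ i → k i ∈K) →
                       (∀ i → k i ≈ 0# ⊎ X (v i)) → ⟪ X ⟫ (sum (λ i → k i * v i))
      combination∈⟪⟫ {zero}  k v k∈ h = ⟪⟫-0
      combination∈⟪⟫ {suc n} k v k∈ h with combination∈⟪⟫ (k ∘ suc) (v ∘ suc) (k∈ ∘ suc) (h ∘ suc) | h zero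
      ... | rec | inj₁ k≈0 = ⟪⟫-resp (sym (k*x+y≈y k≈0)) rec
      ... | rec | inj₂ v∈  = ⟪⟫-cons (k∈ zero) v∈ rec

    span : List Carrier → Subspace K
    span vs = record
      { set = ⟪ X ⟫ ; resp = ⟪⟫-resp X ; 0∈ = ⟪⟫-0 X ; +-closed = ⟪⟫-+ X ; *-closed = ⟪⟫-* X }
      where
      X : Pred Carrier _
      X = _∈ˡ vs

    span-least : ∀ (V : Subspace K) {vs} → All (_∈ᵥ V) vs → span vs ⊆ᵥ V
    span-least V {vs} vs∈ = ⟪⟫-least (_∈ˡ vs) V (λ x∈ → All.lookupₛ setoid (Subspace.resp V) vs∈ x∈)

    span-gen : ∀ {x vs} → x ∈ˡ vs → x ∈ᵥ span vs
    span-gen {vs = vs} = ⟪⟫-gen (_∈ˡ vs)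

    span-mono : ∀ {vs ws} → (∀ {x} → x ∈ˡ vs → x ∈ˡ ws) → span vs ⊆ᵥ span ws
    span-mono {vs} {ws} vs⊆ws = ⟪⟫-least (_∈ˡ vs) (span ws) (span-gen ∘ vs⊆ws)

    span-members : ∀ vs → All (_∈ᵥ span vs) vs
    span-members vs = All.tabulateₛ setoid span-gen

    span-[] : ∀ {x} → x ∈ᵥ span [] → x ≈ 0#
    span-[] (zero , _ , _ , _ , _ , x≈) = x≈
    span-[] (suc m , _ , w∈ , _) = contradiction (w∈ zero) λ ()

    infixr 5 _∷ˢ_
    _∷ˢ_ : Carrier → Subspace K → Subspace K
    v ∷ˢ V = record
      { set      = λ x → ∃[ k ] ∃[ y ] (k ∈K × y ∈ᵥ V × x ≈ k * v + y)
      ; resp     = λ { x≈x′ (k , y , k∈ , y∈ , x≈) → k , y , k∈ , y∈ , trans (sym x≈x′) x≈ }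
      ; 0∈       = 0# , 0# , K.0∈ , V.0∈ , sym (trans (+-identityʳ _) (zeroˡ _))
      ; +-closed = λ { (k , y , k∈ , y∈ , x≈) (k′ , y′ , k′∈ , y′∈ , x′≈) →
          k + k′ , y + y′ , K.+-closed k∈ k′∈ , V.+-closed y∈ y′∈
            , trans (+-cong x≈ x′≈) (trans (+-interchange _ _ _ _) (+-congʳ (sym (distribʳ _ _ _)))) }
      ; *-closed = λ { l∈ (k , y , k∈ , y∈ , x≈) →
          _ , _ , K.*-closed l∈ k∈ , V.*-closed l∈ y∈
            , trans (*-congˡ x≈) (trans (distribˡ _ _ _) (+-congʳ (sym (*-assoc _ _ _)))) }
      }
      where
      module V = Subspace V

    ∷ˢ-tail : ∀ v (V : Subspace K) → V ⊆ᵥ v ∷ˢ V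
    ∷ˢ-tail v V y∈ = 0# , _ , K.0∈ , y∈ , sym (trans (+-congʳ (zeroˡ v)) (+-identityˡ _))

    ∷ˢ-head : ∀ v (V : Subspace K) → v ∈ᵥ v ∷ˢ V
    ∷ˢ-head v V = 1# , 0# , K.1∈ , Subspace.0∈ V , sym (trans (+-identityʳ _) (*-identityˡ _))

    span-split : ∀ {v vs} → span (v ∷ vs) ⊆ᵥ v ∷ˢ span vs
    span-split {v} {vs} = ⟪⟫-least (_∈ˡ v ∷ vs) (v ∷ˢ span vs) λ
      { (here x≈v)  → Subspace.resp (v ∷ˢ span vs) (sym x≈v) (∷ˢ-head v (span vs))
      ; (there x∈) → ∷ˢ-tail v (span vs) (span-gen x∈) }

    -- Stated without coefficients: adjoining a vector outside the span is the constructor itself,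
    -- which is the form used by elimination and by basis extension. `independent-tabulate⁺` and
    -- `independent-tabulate⁻` give the agreement with trivial relations.
    data Independent : List Carrier → Set (c ⊔ ℓ₁ ⊔ ℓ₂) where
      []  : Independent []
      _∷_ : ∀ {v vs} → ¬ (v ∈ᵥ span vs) → Independent vs → Independent (v ∷ vs)

    -- Either vs avoids w altogether, or clearing the w-coordinate with a pivot p costs one vector.
    eliminate : ∀ w ws {vs} → Independent vs → All (_∈ᵥ span (w ∷ ws)) vs →
      All (_∈ᵥ span ws) vs ⊎
      (∃[ vs′ ] (Independent vs′ × All (_∈ᵥ span ws) vs′ × All (_∈ᵥ span vs) vs′ ×
        length vs ≡ suc (length vs′) ×
        ∃[ k ] ∃[ y ] (k ∈K × ¬ (k ≈ 0#) × y ∈ᵥ span ws × k * w + y ∈ᵥ span vs)))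
    eliminate w ws [] [] = inj₁ []
    eliminate w ws {v ∷ vs} (v∉ ∷ ind) (v∈ ∷ vs∈) with eliminate w ws ind vs∈ | span-split v∈
    ... | inj₁ vs∈ws | k , y , k∈ , y∈ , v≈ with em {P = k ≈ 0#}
    ...   | yes k≈0 = inj₁ (Subspace.resp (span ws) (sym (trans v≈ (k*x+y≈y k≈0))) y∈ ∷ vs∈ws)
    ...   | no k≉0  = inj₂ (vs , ind , vs∈ws , All.tabulateₛ setoid (span-gen ∘ there) , ≡.refl
                        , k , y , k∈ , k≉0 , y∈ , span-gen (here (sym v≈)))
    eliminate w ws {v ∷ vs} (v∉ ∷ ind) (v∈ ∷ vs∈)
        | inj₂ (vs′ , ind′ , vs′∈ws , vs′∈vs , eq , k , y , k∈ , k≉0 , y∈ , p∈) | l , z , l∈ , z∈ , v≈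
      with inverse k≉0
    ... | k′ , kk′≈1 = inj₂
          ( v′ ∷ vs′
          , v′∉ ∷ ind′
          , Subspace.resp (span ws) (sym v′≈)
              (Subspace.+-closed (span ws) (Subspace.*-closed (span ws) m∈ y∈) z∈) ∷ vs′∈ws
          , Subspace.+-closed (span (v ∷ vs))
              (Subspace.*-closed (span (v ∷ vs)) m∈ (span-mono there p∈)) (span-gen (here refl))
              ∷ All.map (span-mono there) vs′∈vs
          , ≡.cong suc eq
          , k , y , k∈ , k≉0 , y∈ , span-mono there p∈ )
      where
      -- With this factor the `w`-coordinate `m * k + l` of `v′` vanishes.
      m = - (l * k′)
      m∈ : m ∈K
      m∈ = K.neg-closed (K.*-closed l∈ (K.inv-closed k∈ kk′≈1))
      v′ = m * (k * w + y) + v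
      mk≈-l : m * k ≈ - l
      mk≈-l = trans (sym (-‿distribˡ-* _ _)) (-‿cong (trans (*-assoc _ _ _)
        (trans (*-congˡ (trans (*-comm k′ k) kk′≈1)) (*-identityʳ l))))
      v′≈ : v′ ≈ m * y + z
      v′≈ = begin
        m * (k * w + y) + v                 ≈⟨ +-cong (distribˡ _ _ _) v≈ ⟩
        m * (k * w) + m * y + (l * w + z)   ≈⟨ +-interchange _ _ _ _ ⟩
        m * (k * w) + l * w + (m * y + z)   ≈⟨ +-congʳ (+-congʳ (sym (*-assoc _ _ _))) ⟩
        m * k * w + l * w + (m * y + z)     ≈⟨ +-congʳ (sym (distribʳ _ _ _)) ⟩
        (m * k + l) * w + (m * y + z)       ≈⟨ +-congʳ (*-congʳ (trans (+-congʳ mk≈-l) (-‿inverseˡ l))) ⟩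
        0# * w + (m * y + z)                ≈⟨ +-congʳ (zeroˡ w) ⟩
        0# + (m * y + z)                    ≈⟨ +-identityˡ _ ⟩
        m * y + z                           ∎
        where
        open ≈-Reasoning
      -- The pivot and `vs′` both lie in `span vs`, so `v′` in `span vs′` would put `v` into
      -- `span vs`.
      v′∉ : ¬ (v′ ∈ᵥ span vs′)
      v′∉ v′∈ = v∉ (+-cancelˡ∈ (span vs) (span-least (span vs) vs′∈vs v′∈) (Subspace.*-closed (span vs) m∈ p∈))

    -- By `eliminate`, dropping one vector of the spanning list costs at most one independent
    -- vector.
    steinitz : ∀ ws {vs} → Independent vs → All (_∈ᵥ span ws) vs → length vs ≤ length ws
    steinitz [] [] [] = z≤n
    steinitz [] {v ∷ vs} (v∉ ∷ _) (v∈ ∷ _) =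
      contradiction (Subspace.resp (span vs) (sym (span-[] v∈)) (Subspace.0∈ (span vs))) v∉
    steinitz (w ∷ ws) ind vs∈ with eliminate w ws ind vs∈
    ... | inj₁ vs∈ws = ℕP.m≤n⇒m≤1+n (steinitz ws ind vs∈ws)
    ... | inj₂ (vs′ , ind′ , vs′∈ws , _ , eq , _) =
      ≡.subst (_≤ suc (length ws)) (≡.sym eq) (s≤s (steinitz ws ind′ vs′∈ws))

    record ListBasis (V : Subspace K) (vs : List Carrier) : Set (c ⊔ ℓ₁ ⊔ ℓ₂) where
      constructor listBasis
      field
        independent : Independent vs
        members     : All (_∈ᵥ V) vs
        spanning    : V ⊆ᵥ span vs

    length-basis : ∀ {V vs ws} → ListBasis V vs → ListBasis V ws → length vs ≡ length ws
    length-basis {vs = vs} {ws} bv bw = ℕP.≤-antisym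
      (steinitz ws bv.independent (All.map bw.spanning bv.members))
      (steinitz vs bw.independent (All.map bv.spanning bw.members))
      where
      module bv = ListBasis bv
      module bw = ListBasis bw

    span-basis : ∀ {vs} → Independent vs → ListBasis (span vs) vs
    span-basis ind = listBasis ind (span-members _) (λ x∈ → x∈)

    -- A bound on independent lists rather than a dimension: it passes to subspaces at once, and
    -- over the larger field `K(R)` it follows from the bound over `K`.
    BoundedBy : Subspace K → ℕ → Set (c ⊔ ℓ₁ ⊔ ℓ₂)
    BoundedBy V N = ∀ {vs} → Independent vs → All (_∈ᵥ V) vs → length vs ≤ N

    spanned-bounded : ∀ {V ws} → V ⊆ᵥ span ws → BoundedBy V (length ws)
    spanned-bounded {ws = ws} V⊆ ind vs∈ = steinitz ws ind (All.map V⊆ vs∈)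

    extend : ∀ {V N} → BoundedBy V N → ∀ {vs} → Independent vs → All (_∈ᵥ V) vs →
             ∃[ us ] ListBasis V (us ++ vs)
    extend {V} {N} bound {vs} ind vs∈ = go N ind vs∈ (ℕP.m≤m+n N _)
      where
      -- `d` bounds the number of vectors still to be added; once it is zero, one more would exceed
      -- `N`.
      go : ∀ d {vs} → Independent vs → All (_∈ᵥ V) vs → N ≤ d ℕ.+ length vs → ∃[ us ] ListBasis V (us ++ vs)
      go d {vs} ind vs∈ N≤ with em {P = ∃[ x ] (x ∈ᵥ V × ¬ (x ∈ᵥ span vs))}
      ... | no none = [] , listBasis ind vs∈ λ {x} x∈ → case em {P = x ∈ᵥ span vs} of λ
            { (yes x∈span) → x∈span ; (no x∉span) → contradiction (x , x∈ , x∉span) none }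
      go zero ind vs∈ N≤ | yes (x , x∈ , x∉) = contradiction (bound (x∉ ∷ ind) (x∈ ∷ vs∈)) (ℕP.<⇒≱ (s≤s N≤))
      go (suc d) {vs} ind vs∈ N≤ | yes (x , x∈ , x∉)
        with go d (x∉ ∷ ind) (x∈ ∷ vs∈) (≡.subst (N ≤_) (≡.sym (ℕP.+-suc d (length vs))) N≤)
      ... | us , basis = us ++ x ∷ [] , ≡.subst (ListBasis V) (≡.sym (++-assoc us (x ∷ []) vs)) basis

    independent-++ʳ : ∀ us {vs} → Independent (us ++ vs) → Independent vs
    independent-++ʳ []       ind       = ind
    independent-++ʳ (u ∷ us) (_ ∷ ind) = independent-++ʳ us ind

    independent-++ˡ : ∀ us {vs} → Independent (us ++ vs) → Independent us
    independent-++ˡ []       ind         = []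
    independent-++ˡ (u ∷ us) (u∉ ∷ ind) =
      (λ u∈ → u∉ (span-mono (ListMembershipProperties.∈-++⁺ˡ setoid) u∈)) ∷ independent-++ˡ us ind

    -- A further vector of `V` outside the span would give an independent list longer than `ws`.
    -- Applied to the image of a basis, this makes an injective multiplication on a
    -- finite-dimensional space onto.
    long-spans : ∀ {V vs ws} → V ⊆ᵥ span ws → Independent vs → All (_∈ᵥ V) vs → length ws ≤ length vs →
                 V ⊆ᵥ span vs
    long-spans {V} {vs} {ws} V⊆ ind vs∈ ws≤vs {x} x∈ with em {P = x ∈ᵥ span vs}
    ... | yes x∈span = x∈span
    ... | no x∉span  = contradiction (spanned-bounded {V} {ws} V⊆ (x∉span ∷ ind) (x∈ ∷ vs∈))
      (ℕP.<⇒≱ (s≤s ws≤vs))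

    -- Bases as indexed families, and their coordinates.

    tabulate-combination : ∀ {n} (v : Vector Carrier n) {x} → x ∈ᵥ span (tabulate v) → Combination v x
    tabulate-combination {zero}  v x∈ = (λ ()) , (λ ()) , span-[] x∈
    tabulate-combination {suc n} v x∈ with span-split x∈
    ... | l , y , l∈ , y∈ , x≈ with tabulate-combination (v ∘ suc) y∈
    ...   | k , k∈ , y≈ = (l Vector.∷ k) , (λ { zero → l∈ ; (suc i) → k∈ i }) , trans x≈ (+-congˡ y≈)

    combination-tabulate : ∀ {n} (v : Vector Carrier n) {x} → Combination v x → x ∈ᵥ span (tabulate v)
    combination-tabulate v comb = _ , v , ListMembershipProperties.∈-tabulate⁺ setoid , comb

    OnlyTrivialRelation : ∀ {n} → Vector Carrier n → Set (c ⊔ ℓ₁ ⊔ ℓ₂)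
    OnlyTrivialRelation {n} v = ∀ (k : Vector Carrier n) → (∀ i → k i ∈K) →
      sum (λ i → k i * v i) ≈ 0# → ∀ i → k i ≈ 0#

    independent-tabulate⁺ : ∀ {n} (v : Vector Carrier n) → OnlyTrivialRelation v → Independent (tabulate v)
    independent-tabulate⁺ {zero}  v ind = []
    independent-tabulate⁺ {suc n} v ind = head∉ ∷ independent-tabulate⁺ (v ∘ suc) tail-ind
      where
      head∉ : ¬ (v zero ∈ᵥ span (tabulate (v ∘ suc)))
      head∉ v₀∈ with tabulate-combination (v ∘ suc) (neg∈ (span (tabulate (v ∘ suc))) v₀∈)
      ... | k , k∈ , -v₀≈ = 1≉0 (ind (1# Vector.∷ k) (λ { zero → K.1∈ ; (suc i) → k∈ i })
              (trans (+-cong (*-identityˡ _) (sym -v₀≈)) (-‿inverseʳ _)) zero)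
      tail-ind : OnlyTrivialRelation (v ∘ suc)
      tail-ind k k∈ Σ≈0 i = ind (0# Vector.∷ k) (λ { zero → K.0∈ ; (suc j) → k∈ j })
        (trans (+-cong (zeroˡ _) Σ≈0) (+-identityˡ _)) (suc i)

    independent-tabulate⁻ : ∀ {n} (v : Vector Carrier n) → Independent (tabulate v) → OnlyTrivialRelation v
    independent-tabulate⁻ {zero}  v [] k k∈ Σ≈0 = λ ()
    independent-tabulate⁻ {suc n} v (v₀∉ ∷ ind) k k∈ Σ≈0 = λ { zero → k₀≈0 ; (suc i) → tail i }
      where
      W = span (tabulate (v ∘ suc))
      tail∈ : sum (λ i → k (suc i) * v (suc i)) ∈ᵥ span (tabulate (v ∘ suc))
      tail∈ = combination-tabulate (v ∘ suc) (k ∘ suc , k∈ ∘ suc , refl)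
      k₀≈0 : k zero ≈ 0#
      k₀≈0 with em {P = k zero ≈ 0#}
      ... | yes k₀≈0 = k₀≈0
      ... | no k₀≉0  = contradiction
        (*-cancelˡ∈ W (k∈ zero) k₀≉0 (+-cancelʳ∈ W (Subspace.resp W (sym Σ≈0) (Subspace.0∈ W)) tail∈)) v₀∉
      tail : ∀ i → k (suc i) ≈ 0#
      tail = independent-tabulate⁻ (v ∘ suc) ind (k ∘ suc) (k∈ ∘ suc)
        (trans (sym (k*x+y≈y k₀≈0)) Σ≈0)

    toListBasis : ∀ {V n} {v : Vector Carrier n} → IsBasis V v → ListBasis V (tabulate v)
    toListBasis {V} {v = v} basis = listBasis (independent-tabulate⁺ v (IsBasis.independent basis))
      (AllP.tabulate⁺ (IsBasis.members basis)) (λ x∈ → combination-tabulate v (IsBasis.spans basis x∈))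

    fromListBasis : ∀ {V n} {v : Vector Carrier n} → ListBasis V (tabulate v) → IsBasis V v
    fromListBasis {v = v} (listBasis ind mem spans) = record
      { members     = AllP.tabulate⁻ mem
      ; spans       = λ {x} x∈ → tabulate-combination v {x} (spans x∈)
      ; independent = independent-tabulate⁻ v ind
      }

    lookup-isBasis : ∀ {V vs} → ListBasis V vs → IsBasis V (lookup vs)
    lookup-isBasis {V} {vs} basis = fromListBasis (≡.subst (ListBasis V) (≡.sym (tabulate-lookup vs)) basis)

    independent-or-redundant : ∀ vs →
      Independent vs ⊎ (∃[ us ] (span vs ⊆ᵥ span us × length us < length vs))
    independent-or-redundant [] = inj₁ []
    independent-or-redundant (v ∷ vs) with em {P = v ∈ᵥ span vs} | independent-or-redundant vs
    ... | yes v∈ | _ = inj₂ (vs , span-least (span vs) (v∈ ∷ span-members vs) , ℕP.≤-refl)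
    ... | no v∉ | inj₁ ind = inj₁ (v∉ ∷ ind)
    ... | no v∉ | inj₂ (us , vs⊆us , us<vs) = inj₂ (v ∷ us
        , span-least (span (v ∷ us))
            (span-gen (here refl) ∷ All.map (λ x∈ → span-mono there (vs⊆us x∈)) (span-members vs))
        , s≤s us<vs)

    -- The exchanges below keep track of spanning only. With as many vectors as the dimension this
    -- suffices: a dependent family could be shortened, and too few vectors would span.
    spanning-basis : ∀ {V n} → HasDim V n → (b : Vector Carrier n) → (∀ i → b i ∈ᵥ V) →
                     V ⊆ᵥ span (tabulate b) → IsBasis V b
    spanning-basis {V} {n} (v , v-basis) b b∈ spans with independent-or-redundant (tabulate b)
    ... | inj₁ ind = fromListBasis (listBasis ind (AllP.tabulate⁺ b∈) spans)
    ... | inj₂ (us , b⊆us , us<b) = contradiction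
        (spanned-bounded {V} {us} (λ x∈ → b⊆us (spans x∈)) (ListBasis.independent vb) (ListBasis.members vb))
        (ℕP.<⇒≱ (ℕP.<-≤-trans us<b (ℕP.≤-reflexive (≡.trans (length-tabulate b) (≡.sym (length-tabulate v))))))
      where vb = toListBasis v-basis

    -- For a basis `b` this is the kernel of the `i`-th coordinate functional; it stands in for the
    -- dual basis.
    omitSpan : ∀ {n} → Vector Carrier n → Fin n → Subspace K
    omitSpan b i = record
      { set = ⟪ X ⟫ ; resp = ⟪⟫-resp X ; 0∈ = ⟪⟫-0 X ; +-closed = ⟪⟫-+ X ; *-closed = ⟪⟫-* X }
      where
      X : Pred Carrier _
      X = Omit b i

    summand∈ : ∀ (V : Subspace K) {n} (f : Vector Carrier n) i →
               (∀ j → j ≢ i → f j ∈ᵥ V) → sum f ∈ᵥ V → f i ∈ᵥ V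
    summand∈ V f zero f∈ Σ∈ = +-cancelʳ∈ V Σ∈ (sum∈ V (λ j → f∈ (suc j) λ ()))
    summand∈ V f (suc i) f∈ Σ∈ = summand∈ V (f ∘ suc) i (λ j j≢i → f∈ (suc j) (j≢i ∘ suc-injective))
      (+-cancelˡ∈ V Σ∈ (f∈ zero λ ()))

    -- Otherwise the remaining vectors, one fewer, would span all the independent `b j`, against
    -- `steinitz`.
    member∉omitSpan : ∀ {V n} (b : Vector Carrier n) → IsBasis V b → ∀ i → ¬ (b i ∈ᵥ omitSpan b i)
    member∉omitSpan {V} {suc n} b basis i bᵢ∈ = ℕP.1+n≰n
      (≡.subst₂ _≤_ (length-tabulate b) (length-tabulate others)
        (steinitz (tabulate others) (ListBasis.independent (toListBasis basis)) (AllP.tabulate⁺ b∈)))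
      where
      others : Vector Carrier n
      others j = b (punchIn i j)
      omit⊆ : omitSpan b i ⊆ᵥ span (tabulate others)
      omit⊆ = ⟪⟫-least (Omit b i) (span (tabulate others)) λ { (j , j≢i , x≈) → span-gen
        (≡.subst (λ l → _ ≈ b l → _ ∈ˡ tabulate others) (punchIn-punchOut (j≢i ∘ ≡.sym))
          (λ x≈ → ListMembershipProperties.∈-resp-≈ setoid (sym x≈)
            (ListMembershipProperties.∈-tabulate⁺ setoid _)) x≈) }
      b∈ : ∀ j → b j ∈ᵥ span (tabulate others)
      b∈ j with j ≟ i
      ... | yes ≡.refl = omit⊆ bᵢ∈
      ... | no j≢i     = omit⊆ (⟪⟫-gen (Omit b i) (j , j≢i , refl))

    -- Turns a matching condition into the vanishing of a coordinate: all other summands lie in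
    -- `omitSpan b i`, hence so does `k i * b i`, while `b i` does not.
    omit-coefficient : ∀ {V n} (b : Vector Carrier n) → IsBasis V b →
                       ∀ (k : Vector Carrier n) → (∀ j → k j ∈K) → ∀ i → sum (λ j → k j * b j) ∈ᵥ omitSpan b i → k i ≈ 0#
    omit-coefficient b basis k k∈ i Σ∈ with em {P = k i ≈ 0#}
    ... | yes kᵢ≈0 = kᵢ≈0
    ... | no kᵢ≉0  = contradiction
      (*-cancelˡ∈ (omitSpan b i) (k∈ i) kᵢ≉0 (summand∈ (omitSpan b i) (λ j → k j * b j) i
        (λ j j≢i → Subspace.*-closed (omitSpan b i) (k∈ j) (⟪⟫-gen (Omit b i) (j , j≢i , refl))) Σ∈))
      (member∉omitSpan b basis i)

    -- Shears along a basis vector, and the exchange of two slots.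

    *-cancelʳ-zero∈ : ∀ (V : Subspace K) {k x} → k ∈K → ¬ (x ∈ᵥ V) → k * x ∈ᵥ V → k ≈ 0#
    *-cancelʳ-zero∈ V {k} k∈ x∉ kx∈ with em {P = k ≈ 0#}
    ... | yes k≈0 = k≈0
    ... | no k≉0  = contradiction (*-cancelˡ∈ V k∈ k≉0 kx∈) x∉

    -- If `p` stays outside `v ∷ˢ V`, that space serves with `k` zero. If instead `p ≈ t * v + w`
    -- with `w` in `V`, then `t` is nonzero because `p` is outside `V`, and subtracting `t′ * p`
    -- from `v`, with `t′` the inverse of `t`, leaves a multiple of `w`.
    shear-step : ∀ (V : Subspace K) {p} → ¬ (p ∈ᵥ V) → ∀ v →
      ∃[ W ] (V ⊆ᵥ W × ¬ (p ∈ᵥ W) × ∃[ k ] (k ∈K × v + k * p ∈ᵥ W))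
    shear-step V {p} p∉ v with em {P = p ∈ᵥ v ∷ˢ V}
    ... | no p∉′ = v ∷ˢ V , ∷ˢ-tail v V , p∉′ , 0# , K.0∈
        , Subspace.resp (v ∷ˢ V) (sym (trans (+-congˡ (zeroˡ p)) (+-identityʳ v))) (∷ˢ-head v V)
    ... | yes (t , w , t∈ , w∈ , p≈) with em {P = t ≈ 0#}
    ...   | yes t≈0 = contradiction
              (Subspace.resp V (sym (trans p≈ (k*x+y≈y t≈0))) w∈) p∉
    ...   | no t≉0 with inverse t≉0
    ...     | t′ , tt′≈1 = V , (λ x∈ → x∈) , p∉ , - t′ , K.neg-closed (K.inv-closed t∈ tt′≈1)
              , Subspace.resp V (sym eq) (neg∈ V (Subspace.*-closed V (K.inv-closed t∈ tt′≈1) w∈))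
      where
      open ≈-Reasoning
      eq : v + - t′ * p ≈ - (t′ * w)
      eq = begin
        v + - t′ * p                    ≈⟨ +-congˡ (sym (-‿distribˡ-* t′ p)) ⟩
        v - t′ * p                      ≈⟨ +-congˡ (-‿cong (trans (*-congˡ p≈) (distribˡ t′ _ w))) ⟩
        v - (t′ * (t * v) + t′ * w)     ≈⟨ +-congˡ (-‿cong (+-congʳ (x[yz]≈z v (trans (*-comm t′ t) tt′≈1)))) ⟩
        v - (v + t′ * w)                ≈⟨ +-congˡ (sym (-‿+-comm v (t′ * w))) ⟩
        v + (- v - t′ * w)              ≈⟨ sym (+-assoc v (- v) (- (t′ * w))) ⟩
        v - v - t′ * w                  ≈⟨ +-congʳ (-‿inverseʳ v) ⟩
        0# - t′ * w                     ≈⟨ +-identityˡ _ ⟩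
        - (t′ * w)                      ∎

    -- The projection of each v j along p into W is v j + k * p, so W and p together span every v j.
    complement-of-line : ∀ (V : Subspace K) {p} → ¬ (p ∈ᵥ V) → ∀ {m} (v : Vector Carrier m) →
      ∃[ W ] (V ⊆ᵥ W × ¬ (p ∈ᵥ W) × (∀ j → ∃[ k ] (k ∈K × v j + k * p ∈ᵥ W)))
    complement-of-line V p∉ {zero}  v = V , (λ x∈ → x∈) , p∉ , λ ()
    complement-of-line V p∉ {suc m} v with shear-step V p∉ (v zero)
    ... | W₁ , V⊆W₁ , p∉₁ , k , k∈ , v₀∈ with complement-of-line W₁ p∉₁ (v ∘ suc)
    ...   | W , W₁⊆W , p∉W , tail = W , (λ x∈ → W₁⊆W (V⊆W₁ x∈)) , p∉W
            , λ { zero → k , k∈ , W₁⊆W v₀∈ ; (suc j) → tail j }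

    -- In dual terms, for a basis `b` and `u ≢ k`: slot `u` receives the functional that is one at
    -- `b k` and vanishes on every `sheared j` with `j ≢ k`, the old functional of `u` moves to slot
    -- `k`, and all others stay.
    module Exchange {n} (b : Vector Carrier n) (u k : Fin n) (cs : Vector Carrier n) (cs∈ : ∀ j → cs j ∈K) where

      sheared : Vector Carrier n
      sheared j = b j + cs j * b k

      -- Slot u receives b k, and slot k the sheared old vector b u.
      exchanged : Vector Carrier n
      exchanged j with j ≟ u | j ≟ k
      ... | yes _ | _     = b k
      ... | no _  | yes _ = sheared u
      ... | no _  | no _  = sheared j

      place : Fin n → Fin n
      place j with j ≟ u
      ... | yes _ = k
      ... | no _  = j

      exchanged-u : exchanged u ≡ b k
      exchanged-u with u ≟ u | u ≟ k
      ... | yes _  | _ = ≡.refl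
      ... | no u≢u | _ = contradiction ≡.refl u≢u

      exchanged-place : ∀ {j} → j ≢ k → exchanged (place j) ≡ sheared j
      exchanged-place {j} j≢k with j ≟ u
      ... | yes ≡.refl with k ≟ u | k ≟ k
      ...   | yes ≡.refl | _      = contradiction ≡.refl j≢k
      ...   | no _       | yes _  = ≡.refl
      ...   | no _       | no k≢k = contradiction ≡.refl k≢k
      exchanged-place {j} j≢k | no j≢u with j ≟ u | j ≟ k
      ...   | yes j≡u | _       = contradiction j≡u j≢u
      ...   | no _    | yes j≡k = contradiction j≡k j≢k
      ...   | no _    | no _    = ≡.refl

      place-u : place u ≡ k
      place-u with u ≟ u
      ... | yes _  = ≡.refl
      ... | no u≢u = contradiction ≡.refl u≢u

      place-≢u : ∀ {j} → j ≢ u → place j ≡ j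
      place-≢u {j} j≢u with j ≟ u
      ... | yes j≡u = contradiction j≡u j≢u
      ... | no _    = ≡.refl

      place≢ : ∀ {i j} → i ≢ k → j ≢ i → place j ≢ i
      place≢ {i} {j} i≢k j≢i with j ≟ u
      ... | yes _ = i≢k ∘ ≡.sym
      ... | no _  = j≢i

      place≢u : ∀ {j} → j ≢ k → place j ≢ u
      place≢u {j} j≢k with j ≟ u
      ... | yes j≡u = λ k≡u → j≢k (≡.trans j≡u (≡.sym k≡u))
      ... | no j≢u  = j≢u

      exchanged∈ : ∀ (V : Subspace K) → (∀ j → b j ∈ᵥ V) → ∀ j → exchanged j ∈ᵥ V
      exchanged∈ V b∈ j with j ≟ u | j ≟ k
      ... | yes _ | _     = b∈ k
      ... | no _  | yes _ = Subspace.+-closed V (b∈ u) (Subspace.*-closed V (cs∈ u) (b∈ k))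
      ... | no _  | no _  = Subspace.+-closed V (b∈ j) (Subspace.*-closed V (cs∈ j) (b∈ k))

      omit-exchanged⊆ : ∀ (W : Subspace K) → (∀ j → sheared j ∈ᵥ W) → omitSpan exchanged u ⊆ᵥ W
      omit-exchanged⊆ W sheared∈ = ⟪⟫-least (Omit exchanged u) W λ
        { (j , j≢u , x≈) → Subspace.resp W (sym x≈) (go j j≢u) }
        where
        go : ∀ j → j ≢ u → exchanged j ∈ᵥ W
        go j j≢u with j ≟ u | j ≟ k
        ... | yes j≡u | _     = contradiction j≡u j≢u
        ... | no _    | yes _ = sheared∈ u
        ... | no _    | no _  = sheared∈ j

      -- The shear is undone by subtracting a multiple of `b k`, which is available in slot `u`.
      original∈ : ∀ (W : Subspace K) → exchanged u ∈ᵥ W → ∀ j → (j ≢ k → exchanged (place j) ∈ᵥ W) → b j ∈ᵥ W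
      original∈ W u∈ j place∈ with j ≟ k
      ... | yes ≡.refl = ≡.subst (_∈ᵥ W) exchanged-u u∈
      ... | no j≢k = +-cancelʳ∈ W (≡.subst (_∈ᵥ W) (exchanged-place j≢k) (place∈ j≢k))
                       (Subspace.*-closed W (cs∈ j) (≡.subst (_∈ᵥ W) exchanged-u u∈))

      span-exchanged : span (tabulate b) ⊆ᵥ span (tabulate exchanged)
      span-exchanged = span-least W (AllP.tabulate⁺ λ j → original∈ W (vec u) j (λ _ → vec (place j)))
        where
        W = span (tabulate exchanged)
        vec : ∀ j → exchanged j ∈ᵥ W
        vec j = span-gen (ListMembershipProperties.∈-tabulate⁺ setoid j)

      -- Recovering `b j` with `j ≢ i` uses only the slots `u` and `place j`, and neither of them is
      -- `i`.
      omitSpan-exchanged : ∀ {i} → i ≢ u → i ≢ k → omitSpan b i ⊆ᵥ omitSpan exchanged i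
      omitSpan-exchanged {i} i≢u i≢k = ⟪⟫-least (Omit b i) W λ { (j , j≢i , x≈) →
        Subspace.resp W (sym x≈) (original∈ W (vec u (i≢u ∘ ≡.sym)) j (λ _ → vec (place j) (place≢ i≢k j≢i))) }
        where
        W = omitSpan exchanged i
        vec : ∀ j → j ≢ i → exchanged j ∈ᵥ W
        vec j j≢i = ⟪⟫-gen (Omit exchanged i) (j , j≢i , refl)

      -- Write `x` as `t * b k + y` with `y` in the span of the other slots, which lies in `W`. Then
      -- `t * b k` is in `W`, and `b k` is not, so `t` is zero.
      ⊆-omitSpan-exchanged : ∀ (W : Subspace K) → ¬ (b k ∈ᵥ W) → (∀ j → sheared j ∈ᵥ W) →
        ∀ {x} → x ∈ᵥ span (tabulate b) → x ∈ᵥ W → x ∈ᵥ omitSpan exchanged u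
      ⊆-omitSpan-exchanged W bₖ∉ sheared∈ x∈ x∈W with span-least M (AllP.tabulate⁺ b∈M) x∈
        where
        M = b k ∷ˢ omitSpan exchanged u
        b∈M : ∀ j → b j ∈ᵥ M
        b∈M j = original∈ M (≡.subst (_∈ᵥ M) (≡.sym exchanged-u) (∷ˢ-head (b k) (omitSpan exchanged u))) j λ j≢k →
          ∷ˢ-tail (b k) (omitSpan exchanged u) (⟪⟫-gen (Omit exchanged u) (place j , place≢u j≢k , refl))
      ... | t , y , t∈ , y∈ , x≈ = Subspace.resp (omitSpan exchanged u)
              (sym (trans x≈ (k*x+y≈y t≈0))) y∈
        where
        t≈0 : t ≈ 0#
        t≈0 = *-cancelʳ-zero∈ W t∈ bₖ∉
          (+-cancelʳ∈ W (Subspace.resp W x≈ x∈W) (omit-exchanged⊆ W sheared∈ y∈))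

      -- When `b j` is already in `W`, so is `cs j * b k`, which forces `cs j` to be zero: such
      -- vectors are moved but not altered. This makes it possible to follow them through a chain of
      -- exchanges.
      exchanged-fixed : ∀ (W : Subspace K) → ¬ (b k ∈ᵥ W) → (∀ j → sheared j ∈ᵥ W) →
        ∀ {j} → b j ∈ᵥ W → exchanged (place j) ≈ b j
      exchanged-fixed W bₖ∉ sheared∈ {j} bⱼ∈ = trans (reflexive (exchanged-place λ { ≡.refl → bₖ∉ bⱼ∈ }))
        (trans (+-comm (b j) _) (k*x+y≈y (*-cancelʳ-zero∈ W (cs∈ j) bₖ∉ (+-cancelˡ∈ W (sheared∈ j) bⱼ∈))))

    -- Rado's theorem with defect, by exchanges from a maximal matching.

    module Rado (B : Subspace K) {n} (V : Fin n → Subspace K) (V⊆B : ∀ i → V i ⊆ᵥ B) where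

      record Matching : Set (c ⊔ ℓ₁ ⊔ ℓ₂) where
        field
          b       : Vector Carrier n
          b∈      : ∀ i → b i ∈ᵥ B
          spans   : B ⊆ᵥ span (tabulate b)
          P       : FS.Subset n
          matched : ∀ {i} → i FS.∈ P → V i ⊆ᵥ omitSpan b i

      open Matching

      -- A complement `W` of the line through `b s k` that contains `V u` can serve as the new
      -- kernel at `u`. Label `u` is gained at the price of `k`, and the other matched labels
      -- survive. The two extra clauses tell where the vectors of `V u` go.
      exchange : ∀ (s : Matching) {u k} → ¬ (b s k ∈ᵥ V u) → Σ[ s′ ∈ Matching ]
        ((∀ {j} → j ≢ u → b s j ∈ᵥ V u → b s′ j ≈ b s j) × (b s u ∈ᵥ V u → b s′ k ≈ b s u))
      exchange s {u} {k} bₖ∉ with complement-of-line (V u) bₖ∉ (b s)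
      ... | W , V⊆W , bₖ∉W , shear = record
          { b = exchanged
          ; b∈ = exchanged∈ B (b∈ s)
          ; spans = λ x∈ → span-exchanged (spans s x∈)
          -- Removal comes first so that `u` ends up matched even when `k` equals `u`.
          ; P = (P s [ k ]≔ FS.outside) [ u ]≔ FS.inside
          ; matched = matched′
          }
        , (λ {j} j≢u bⱼ∈ → ≡.subst (λ l → exchanged l ≈ b s j) (place-≢u j≢u) (fixed bⱼ∈))
        , (λ bᵤ∈ → ≡.subst (λ l → exchanged l ≈ b s u) place-u (fixed bᵤ∈))
        where
        open Exchange (b s) u k (proj₁ ∘ shear) (λ j → proj₁ (proj₂ (shear j)))
        sheared∈ : ∀ j → sheared j ∈ᵥ W
        sheared∈ j = proj₂ (proj₂ (shear j))
        fixed : ∀ {j} → b s j ∈ᵥ V u → exchanged (place j) ≈ b s j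
        fixed bⱼ∈ = exchanged-fixed W bₖ∉W sheared∈ (V⊆W bⱼ∈)
        matched′ : ∀ {i} → i FS.∈ ((P s [ k ]≔ FS.outside) [ u ]≔ FS.inside) → V i ⊆ᵥ omitSpan exchanged i
        matched′ {i} i∈ x∈ with i ≟ u
        ... | yes ≡.refl = ⊆-omitSpan-exchanged W bₖ∉W sheared∈ (spans s (V⊆B u x∈)) (V⊆W x∈)
        ... | no i≢u with i ≟ k | ∈-insert⁻ _ i≢u i∈
        ...   | yes ≡.refl | i∈′ = contradiction i∈′ (∉-remove (P s) i)
        ...   | no i≢k     | i∈′ = omitSpan-exchanged i≢u i≢k (matched s (∈-remove⁻ (P s) i∈′) x∈)

      module Violator (s₀ : Matching) (maximal : ∀ s → FS.∣ P s ∣ ≤ FS.∣ P s₀ ∣) where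

        -- Each step trades a matched `k` for an unmatched `u`, so every reachable state is again
        -- maximal.
        data Reachable : Matching → Set (c ⊔ ℓ₁ ⊔ ℓ₂) where
          origin : Reachable s₀
          step  : ∀ {s} → Reachable s → ∀ {u k} → u FS.∉ P s → k FS.∈ P s → (bₖ∉ : ¬ (b s k ∈ᵥ V u)) →
                  Reachable (proj₁ (exchange s bₖ∉))

        -- The labels that some maximal matching reachable from s₀ leaves unmatched.
        J : Fin n → Set (c ⊔ ℓ₁ ⊔ ℓ₂)
        J u = ∃[ s ] (Reachable s × u FS.∉ P s)

        Inner : Matching → Fin n → Set (c ⊔ ℓ₁ ⊔ ℓ₂)
        Inner s k = k FS.∈ P s × J k

        ∣P∣-reachable : ∀ {s} → Reachable s → FS.∣ P s ∣ ≡ FS.∣ P s₀ ∣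
        ∣P∣-reachable origin = ≡.refl
        ∣P∣-reachable (step {s} r u∉ k∈ bₖ∉) = ≡.trans (∣insert∣ _ (u∉ ∘ ∈-remove⁻ (P s)))
          (≡.trans (∣remove∣ (P s) k∈) (∣P∣-reachable r))

        -- Otherwise `u` could be exchanged against `k`. If `k` is matched, the result leaves it
        -- unmatched, so `k` is in `J` and hence inner; if it is not, nothing is given up and `P`
        -- grows beyond the maximum.
        outer∈V : ∀ {s} → Reachable s → ∀ {u k} → u FS.∉ P s → ¬ Inner s k → b s k ∈ᵥ V u
        outer∈V {s} r {u} {k} u∉ k∉ with em {P = b s k ∈ᵥ V u} | em {P = k FS.∈ P s}
        ... | yes bₖ∈ | _ = bₖ∈
        ... | no bₖ∉ | yes k∈ = contradiction (k∈ , proj₁ (exchange s bₖ∉) , step r u∉ k∈ bₖ∉ , k∉′) k∉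
          where
          k∉′ : k FS.∉ P (proj₁ (exchange s bₖ∉))
          k∉′ k∈′ = ∉-remove (P s) k (∈-insert⁻ _ (λ { ≡.refl → u∉ k∈ }) k∈′)
        ... | no bₖ∉ | no k∉P = contradiction (maximal (proj₁ (exchange s bₖ∉)))
          (ℕP.<⇒≱ (ℕP.≤-reflexive (≡.trans
            (≡.cong suc (≡.trans (≡.sym (∣P∣-reachable r)) (≡.sym (∣remove∣-∉ (P s) k∉P))))
            (≡.sym (∣insert∣ _ (u∉ ∘ ∈-remove⁻ (P s)))))))

        -- The vectors at outer positions are only permuted by the exchanges.
        outer-preserved : ∀ {s} → Reachable s → ∀ {k₀} → ¬ Inner s₀ k₀ → ∃[ k ] (¬ Inner s k × b s k ≈ b s₀ k₀)
        outer-preserved origin k₀∉ = _ , k₀∉ , refl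
        outer-preserved (step {s} r {u} {k} u∉ k∈ bₖ∉) {k₀} k₀∉ with outer-preserved r k₀∉
        ... | l , l∉ , bₗ≈ with l ≟ u
        ...   | yes ≡.refl = k , (λ { (k∈′ , _) → ∉-remove (P s) k
                  (∈-insert⁻ _ (λ { ≡.refl → u∉ k∈ }) k∈′) })
                , trans (proj₂ (proj₂ (exchange s bₖ∉)) (outer∈V r u∉ l∉)) bₗ≈
        ...   | no l≢u = l
                , (λ { (l∈′ , jl) → l∉ (∈-remove⁻ (P s) (∈-insert⁻ _ l≢u l∈′) , jl) })
                , trans (proj₁ (proj₂ (exchange s bₖ∉)) l≢u (outer∈V r u∉ l∉)) bₗ≈

        -- The vector is followed to a state that leaves `u` unmatched, where `outer∈V` applies to
        -- it.
        outer∈J : ∀ {u k} → J u → ¬ Inner s₀ k → b s₀ k ∈ᵥ V u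
        outer∈J {u} (s , r , u∉) k∉ with outer-preserved r k∉
        ... | l , l∉ , bₗ≈ = Subspace.resp (V u) bₗ≈ (outer∈V r u∉ l∉)

      maximal-matching : Matching → ∃[ s ] (∀ s′ → FS.∣ P s′ ∣ ≤ FS.∣ P s ∣)
      -- A largest `P` is obtained as a least defect.
      maximal-matching s with least em (λ d → ∃[ s ] n ℕ.∸ FS.∣ P s ∣ ≡ d) (n ℕ.∸ FS.∣ P s ∣) (s , ≡.refl)
      ... | d , (s₁ , ≡.refl) , d-least = s₁ , λ s′ →
              ℕP.∸-cancelʳ-≤ (FSP.∣p∣≤n (P s′)) (d-least _ (s′ , ≡.refl))

    -- Subfamilies, sums and multiples of subspaces, and the transform.

    pick : ∀ {n} → Vector Carrier n → FS.Subset n → List Carrier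
    pick v []                = []
    pick v (FS.inside  ∷ q) = v zero ∷ pick (v ∘ suc) q
    pick v (FS.outside ∷ q) = pick (v ∘ suc) q

    length-pick : ∀ {n} (v : Vector Carrier n) q → length (pick v q) ≡ FS.∣ q ∣
    length-pick v []                = ≡.refl
    length-pick v (FS.inside  ∷ q) = ≡.cong suc (length-pick (v ∘ suc) q)
    length-pick v (FS.outside ∷ q) = length-pick (v ∘ suc) q

    All-pick : ∀ {p} {X : Pred Carrier p} {n} (v : Vector Carrier n) q →
               (∀ {i} → i FS.∈ q → X (v i)) → All X (pick v q)
    All-pick v []                X∈ = []
    All-pick v (FS.inside  ∷ q) X∈ = X∈ here ∷ All-pick (v ∘ suc) q (X∈ ∘ there)
    All-pick v (FS.outside ∷ q) X∈ = All-pick (v ∘ suc) q (X∈ ∘ there)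

    pick⊆tabulate : ∀ {n} (v : Vector Carrier n) q {x} → x ∈ˡ pick v q → x ∈ˡ tabulate v
    pick⊆tabulate v (FS.inside  ∷ q) (here x≈)  = here x≈
    pick⊆tabulate v (FS.inside  ∷ q) (there x∈) = there (pick⊆tabulate (v ∘ suc) q x∈)
    pick⊆tabulate v (FS.outside ∷ q) x∈         = there (pick⊆tabulate (v ∘ suc) q x∈)

    independent-pick : ∀ {n} (v : Vector Carrier n) q → Independent (tabulate v) → Independent (pick v q)
    independent-pick v []                ind        = []
    independent-pick v (FS.inside  ∷ q) (v₀∉ ∷ ind) =
      (λ v₀∈ → v₀∉ (span-mono (pick⊆tabulate (v ∘ suc) q) v₀∈)) ∷ independent-pick (v ∘ suc) q ind
    independent-pick v (FS.outside ∷ q) (v₀∉ ∷ ind) = independent-pick (v ∘ suc) q ind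

    infixr 5 _⊞_
    _⊞_ : Subspace K → Subspace K → Subspace K
    V ⊞ W = record
      { set      = λ x → ∃[ v ] ∃[ w ] (v ∈ᵥ V × w ∈ᵥ W × x ≈ v + w)
      ; resp     = λ { x≈x′ (v , w , v∈ , w∈ , x≈) → v , w , v∈ , w∈ , trans (sym x≈x′) x≈ }
      ; 0∈       = 0# , 0# , V.0∈ , W.0∈ , sym (+-identityˡ 0#)
      ; +-closed = λ { (v , w , v∈ , w∈ , x≈) (v′ , w′ , v′∈ , w′∈ , x′≈) →
          v + v′ , w + w′ , V.+-closed v∈ v′∈ , W.+-closed w∈ w′∈
            , trans (+-cong x≈ x′≈) (+-interchange v w v′ w′) }
      ; *-closed = λ { {k} k∈ (v , w , v∈ , w∈ , x≈) →
          k * v , k * w , V.*-closed k∈ v∈ , W.*-closed k∈ w∈ , trans (*-congˡ x≈) (distribˡ k v w) }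
      }
      where
      module V = Subspace V
      module W = Subspace W

    infixr 8 _·ˢ_
    _·ˢ_ : Carrier → Subspace K → Subspace K
    e ·ˢ V = record
      { set      = λ x → ∃[ v ] (v ∈ᵥ V × x ≈ e * v)
      ; resp     = λ { x≈x′ (v , v∈ , x≈) → v , v∈ , trans (sym x≈x′) x≈ }
      ; 0∈       = 0# , V.0∈ , sym (zeroʳ e)
      ; +-closed = λ { (v , v∈ , x≈) (v′ , v′∈ , x′≈) →
          v + v′ , V.+-closed v∈ v′∈ , trans (+-cong x≈ x′≈) (sym (distribˡ e v v′)) }
      ; *-closed = λ { {k} k∈ (v , v∈ , x≈) →
          k * v , V.*-closed k∈ v∈ , trans (*-congˡ x≈) (x[yz]≈y[xz] k e v) }
      }
      where
      module V = Subspace V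

    -- Phrased by `e * x` instead of an inverse, so it is a subspace for every `e`; for `e ≈ 0#` it
    -- is all of `W`.
    infix 8 _⁻¹·ˢ_∩_
    _⁻¹·ˢ_∩_ : Carrier → Subspace K → Subspace K → Subspace K
    e ⁻¹·ˢ V ∩ W = record
      { set      = λ x → x ∈ᵥ W × e * x ∈ᵥ V
      ; resp     = λ { x≈y (x∈ , ex∈) → W.resp x≈y x∈ , V.resp (*-congˡ x≈y) ex∈ }
      ; 0∈       = W.0∈ , V.resp (sym (zeroʳ e)) V.0∈
      ; +-closed = λ { (x∈ , ex∈) (y∈ , ey∈) →
          W.+-closed x∈ y∈ , V.resp (sym (distribˡ e _ _)) (V.+-closed ex∈ ey∈) }
      ; *-closed = λ { k∈ (x∈ , ex∈) → W.*-closed k∈ x∈ , V.resp (x[yz]≈y[xz] _ e _) (V.*-closed k∈ ex∈) }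
      }
      where
      module V = Subspace V
      module W = Subspace W

    span-++ : ∀ us {vs} → span (us ++ vs) ⊆ᵥ span us ⊞ span vs
    span-++ us {vs} = span-least (span us ⊞ span vs) (AllP.++⁺
      (All.map (λ {x} x∈ → x , 0# , x∈ , Subspace.0∈ (span vs) , sym (+-identityʳ x)) (span-members us))
      (All.map (λ {x} x∈ → 0# , x , Subspace.0∈ (span us) , x∈ , sym (+-identityˡ x)) (span-members vs)))

    span-map : ∀ e vs → span (map (e *_) vs) ⊆ᵥ e ·ˢ span vs
    span-map e vs = span-least (e ·ˢ span vs) (AllP.map⁺ (All.map (λ {x} x∈ → x , x∈ , refl) (span-members vs)))

    span-++ˡ : ∀ us {vs} → span us ⊆ᵥ span (us ++ vs)
    span-++ˡ us = span-mono (ListMembershipProperties.∈-++⁺ˡ setoid)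

    span-++ʳ : ∀ us {vs} → span vs ⊆ᵥ span (us ++ vs)
    span-++ʳ us = span-mono (ListMembershipProperties.∈-++⁺ʳ setoid us)

    independent-map : ∀ {e} → ¬ (e ≈ 0#) → ∀ {vs} → Independent vs → Independent (map (e *_) vs)
    independent-map e≉0 [] = []
    independent-map {e} e≉0 {v ∷ vs} (v∉ ∷ ind) = ev∉ ∷ independent-map e≉0 ind
      where
      ev∉ : ¬ (e * v ∈ᵥ span (map (e *_) vs))
      ev∉ ev∈ with span-map e vs ev∈ | inverse e≉0
      ... | y , y∈ , ev≈ey | e′ , ee′≈1 = v∉ (Subspace.resp (span vs) (sym v≈y) y∈)
        where
        e′e≈1 = trans (*-comm e′ e) ee′≈1
        v≈y : v ≈ y
        v≈y = trans (sym (x[yz]≈z v e′e≈1)) (trans (*-congˡ ev≈ey) (x[yz]≈z y e′e≈1))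

    disjoint-++ : ∀ us {vs} → Independent (us ++ vs) → ∀ {x} → x ∈ᵥ span vs → x ∈ᵥ span us → x ≈ 0#
    disjoint-++ []       ind        x∈vs x∈[] = span-[] x∈[]
    disjoint-++ (u ∷ us) {vs} (u∉ ∷ ind) x∈vs x∈us with span-split x∈us
    ... | k , y , k∈ , y∈ , x≈ = trans x≈y (disjoint-++ us ind (Subspace.resp (span vs) x≈y x∈vs) y∈)
      where
      W = span (us ++ vs)
      k≈0 : k ≈ 0#
      k≈0 = *-cancelʳ-zero∈ W k∈ u∉ (+-cancelʳ∈ W (Subspace.resp W x≈ (span-++ʳ us x∈vs)) (span-++ˡ us y∈))
      x≈y = trans x≈ (k*x+y≈y k≈0)

    basis-⊕ : ∀ {V us vs} → ListBasis V (us ++ vs) → V ≐ span vs ⊕ span us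
    basis-⊕ {V} {us} {vs} (listBasis ind mem spans) = record
      { contains = λ s∈ y∈ → Subspace.+-closed V
          (span-least V (AllP.++⁻ʳ us mem) s∈) (span-least V (AllP.++⁻ˡ us mem) y∈)
      ; spans    = λ x∈ → case span-++ us (spans x∈) of λ
          { (u , v , u∈ , v∈ , x≈) → v , u , v∈ , u∈ , trans x≈ (+-comm u v) }
      ; disjoint = disjoint-++ us ind
      }

    span-hasDim : ∀ {vs} → Independent vs → HasDim (span vs) (length vs)
    span-hasDim {vs} ind = lookup vs , lookup-isBasis (span-basis ind)

    -- The linear Dyson e-transform (T, R) ↦ (T + eR, R ∩ e⁻¹T): it preserves T R ⊆ A and dim T + dim R.
    module Transform (A B : Subspace K) where

      record Pair : Set (c ⊔ ℓ₁ ⊔ ℓ₂) where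
        field
          ts rs    : List Carrier
          ts-ind   : Independent ts
          rs-ind   : Independent rs
          ts⊆A     : All (_∈ᵥ A) ts
          rs⊆B     : All (_∈ᵥ B) rs
          product∈ : ∀ {t r} → t ∈ᵥ span ts → r ∈ᵥ span rs → t * r ∈ᵥ A

      open Pair

      Stable : Pair → Set (c ⊔ ℓ₁ ⊔ ℓ₂)
      Stable p = ∀ {t r} → t ∈ᵥ span (ts p) → r ∈ᵥ span (rs p) → t * r ∈ᵥ span (ts p)

      size : Pair → ℕ
      size p = length (ts p) ℕ.+ length (rs p)

      -- A basis of `R′` is completed by `xs` to a basis of `R`, and the vectors `e * x` are handed
      -- over to `T`, so the size is kept term by term. If `xs` were empty, `R` would lie in `R′`
      -- and `e * r` in `T`; hence `R` strictly shrinks.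
      transform : ∀ p {e r} → e ∈ᵥ span (ts p) → r ∈ᵥ span (rs p) → ¬ (e * r ∈ᵥ span (ts p)) →
                  ∃[ q ] (size q ≡ size p × length (rs q) < length (rs p))
      transform p {e} {r} e∈ r∈ er∉ with
        extend {e ⁻¹·ˢ span (ts p) ∩ span (rs p)}
          (spanned-bounded {e ⁻¹·ˢ span (ts p) ∩ span (rs p)} {rs p} proj₁) [] []
      ... | us , R′-basis with extend {span (rs p)} (spanned-bounded {span (rs p)} {rs p} (λ x∈ → x∈))
                                 (ListBasis.independent R′-basis) (All.map proj₁ (ListBasis.members R′-basis))
      ...   | xs , R-basis = q , size≡ , rs′<rs xs R-basis
        where
        T = span (ts p)
        R = span (rs p)
        R′ = e ⁻¹·ˢ T ∩ R
        rs′ = us ++ []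
        ts′ = map (e *_) xs ++ ts p

        R′⊆ : span rs′ ⊆ᵥ R′
        R′⊆ = span-least R′ (ListBasis.members R′-basis)

        xs⊆R : All (_∈ᵥ R) xs
        xs⊆R = AllP.++⁻ˡ xs (ListBasis.members R-basis)

        ts′-ind : ∀ xs → All (_∈ᵥ R) xs → Independent (xs ++ rs′) → Independent (map (e *_) xs ++ ts p)
        ts′-ind [] [] ind = ts-ind p
        ts′-ind (x ∷ xs) (x∈ ∷ xs∈) (x∉ ∷ ind) = ex∉ ∷ ts′-ind xs xs∈ ind
          where
          -- If `e * x` were `e * y + t` with `t` in `T` and `y` in the span of `xs`, then `x - y`
          -- would lie in `R′`, and `x` would depend on `xs` and `rs′`.
          ex∉ : ¬ (e * x ∈ᵥ span (map (e *_) xs ++ ts p))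
          ex∉ ex∈ with span-++ (map (e *_) xs) ex∈
          ... | z , t , z∈ , t∈ , ex≈ with span-map e xs z∈
          ...   | y , y∈ , z≈ = x∉ (+-cancelʳ∈ W
                    (span-++ʳ xs (ListBasis.spanning R′-basis
                      (Subspace.+-closed R x∈ (neg∈ R (span-least R xs∈ y∈))
                        , Subspace.resp T (sym e[x-y]≈t) t∈)))
                    (neg∈ W (span-++ˡ xs y∈)))
            where
            W = span (xs ++ rs′)
            e[x-y]≈t : e * (x - y) ≈ t
            e[x-y]≈t = begin
              e * (x - y)           ≈⟨ distribˡ e x (- y) ⟩
              e * x + e * - y       ≈⟨ +-cong (trans ex≈ (+-comm z t)) (sym (-‿distribʳ-* e y)) ⟩
              t + z - e * y         ≈⟨ +-congˡ (-‿cong (sym z≈)) ⟩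
              t + z - z             ≈⟨ [x+y]-y≈x t z ⟩
              t                     ∎
              where
              open ≈-Reasoning

        -- The part `e * y` of `t` is handled by regrouping its product with `r` as `e * r * y`:
        -- here `e * r` is in `T` because `r` is in `R′`.
        product′∈ : ∀ {t r} → t ∈ᵥ span ts′ → r ∈ᵥ span rs′ → t * r ∈ᵥ A
        product′∈ {t} {r} t∈ r∈ with span-++ (map (e *_) xs) t∈ | R′⊆ r∈
        ... | z , t₀ , z∈ , t₀∈ , t≈ | r∈R , er∈T with span-map e xs z∈
        ...   | y , y∈ , z≈ = Subspace.resp A (sym eq)
                  (Subspace.+-closed A (product∈ p er∈T (span-least R xs⊆R y∈)) (product∈ p t₀∈ r∈R))
          where
          open ≈-Reasoning
          eq : t * r ≈ e * r * y + t₀ * r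
          eq = begin
            t * r                 ≈⟨ *-congʳ (trans t≈ (+-congʳ z≈)) ⟩
            (e * y + t₀) * r      ≈⟨ distribʳ r (e * y) t₀ ⟩
            e * y * r + t₀ * r    ≈⟨ +-congʳ (trans (*-assoc e y r) (trans (*-congˡ (*-comm y r))
                                       (sym (*-assoc e r y)))) ⟩
            e * r * y + t₀ * r    ∎

        q : Pair
        q = record
          { ts = ts′ ; rs = rs′
          ; ts-ind = ts′-ind xs xs⊆R (ListBasis.independent R-basis)
          ; rs-ind = ListBasis.independent R′-basis
          ; ts⊆A = AllP.++⁺ (AllP.map⁺ (All.map (product∈ p e∈) xs⊆R)) (ts⊆A p)
          ; rs⊆B = All.map (λ x∈ → span-least B (rs⊆B p) (proj₁ x∈)) (ListBasis.members R′-basis)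
          ; product∈ = product′∈
          }

        xs+rs′ : ∀ xs → ListBasis R (xs ++ rs′) → length xs ℕ.+ length rs′ ≡ length (rs p)
        xs+rs′ xs basis = ≡.trans (≡.sym (length-++ xs)) (length-basis basis (span-basis (rs-ind p)))

        size≡ : length ts′ ℕ.+ length rs′ ≡ length (ts p) ℕ.+ length (rs p)
        size≡ = begin
          length ts′ ℕ.+ length rs′
            ≡⟨ ≡.cong (ℕ._+ length rs′) (length-++ (map (e *_) xs)) ⟩
          length (map (e *_) xs) ℕ.+ length (ts p) ℕ.+ length rs′
            ≡⟨ ≡.cong (λ l → l ℕ.+ length (ts p) ℕ.+ length rs′) (length-map (e *_) xs) ⟩
          length xs ℕ.+ length (ts p) ℕ.+ length rs′
            ≡⟨ ≡.cong (ℕ._+ length rs′) (ℕP.+-comm (length xs) _) ⟩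
          length (ts p) ℕ.+ length xs ℕ.+ length rs′        ≡⟨ ℕP.+-assoc (length (ts p)) _ _ ⟩
          length (ts p) ℕ.+ (length xs ℕ.+ length rs′)      ≡⟨ ≡.cong (length (ts p) ℕ.+_) (xs+rs′ xs R-basis) ⟩
          length (ts p) ℕ.+ length (rs p)                   ∎
          where
          open ≡.≡-Reasoning

        rs′<rs : ∀ xs → ListBasis R (xs ++ rs′) → length rs′ < length (rs p)
        rs′<rs []       basis = contradiction (proj₂ (R′⊆ (ListBasis.spanning basis r∈))) er∉
        rs′<rs (x ∷ xs) basis = ≡.subst (length rs′ <_) (xs+rs′ (x ∷ xs) basis) (s≤s (ℕP.m≤n+m _ (length xs)))

      stabilize : ∀ p → ∃[ q ] (size q ≡ size p × Stable q)
      stabilize p = go (length (rs p)) p ℕP.≤-refl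
        where
        go : ∀ d p → length (rs p) ≤ d → ∃[ q ] (size q ≡ size p × Stable q)
        go d p rs≤d with em {P = ∃[ e ] ∃[ r ] (e ∈ᵥ span (ts p) × r ∈ᵥ span (rs p) × ¬ (e * r ∈ᵥ span (ts p)))}
        ... | no stable = p , ≡.refl , λ {e} {r} e∈ r∈ → case em {P = e * r ∈ᵥ span (ts p)} of λ
                { (yes er∈) → er∈ ; (no er∉) → contradiction (e , r , e∈ , r∈ , er∉) stable }
        ... | yes (e , r , e∈ , r∈ , er∉) with transform p e∈ r∈ er∉
        ...   | q , size≡ , q<p with d | ℕP.≤-trans q<p rs≤d
        ...     | suc d′ | s≤s q≤d′ with go d′ q q≤d′
        ...       | q′ , size′≡ , stable = q′ , ≡.trans size′≡ size≡ , stable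

    -- Matchings against pairs of subspaces with products in `A`.

    ∈-pick : ∀ {n} (v : Vector Carrier n) {q i} → i FS.∈ q → v i ∈ˡ pick v q
    ∈-pick v {FS.inside  ∷ q} here       = here refl
    ∈-pick v {FS.inside  ∷ q} (there i∈) = there (∈-pick (v ∘ suc) i∈)
    ∈-pick v {FS.outside ∷ q} (there i∈) = ∈-pick (v ∘ suc) i∈

    prefix-positions : ∀ us {vs} → Σ[ q ∈ FS.Subset (length (us ++ vs)) ]
      (FS.∣ q ∣ ≡ length us × (∀ {i} → i FS.∉ q → lookup (us ++ vs) i ∈ˡ vs))
    prefix-positions [] {vs} = FS.⊥ , FSP.∣⊥∣≡0 (length vs)
      , λ {i} _ → ListMembershipProperties.∈-lookup setoid vs i
    prefix-positions (u ∷ us) {vs} with prefix-positions us {vs}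
    ... | q , eq , rest = FS.inside ∷ q , ≡.cong suc eq
        , λ { {zero} i∉ → contradiction here i∉ ; {suc i} i∉ → rest (i∉ ∘ there) }

    basis-member≉0 : ∀ {V n} {a : Vector Carrier n} → IsBasis V a → ∀ i → ¬ (a i ≈ 0#)
    basis-member≉0 {a = a} basis i aᵢ≈0 = member∉omitSpan a basis i
      (Subspace.resp (omitSpan a i) (sym aᵢ≈0) (Subspace.0∈ (omitSpan a i)))

    -- Matching the vectors of ss confines R to the span of the b j with j ∉ P or a j ∈ us.
    matched-bound : ∀ {A B R : Subspace K} {us ss rs d} → ListBasis A (us ++ ss) →
      R ⊆ᵥ B → (∀ {s r} → s ∈ᵥ span ss → r ∈ᵥ R → s * r ∈ᵥ A) →
      Independent rs → All (_∈ᵥ R) rs →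
      PartiallyMatched A B (length (us ++ ss)) d → length rs ≤ d ℕ.+ length us
    matched-bound {A} {B} {R} {us} {ss} {rs} {d} a-basis R⊆B product∈ rs-ind rs⊆R (d≤n , pm)
      with pm (lookup (us ++ ss)) (lookup-isBasis a-basis) | prefix-positions us {ss}
    ... | b , b-basis , P , ∣P∣≡ , matched | q , ∣q∣≡ , rest =
      ≡.subst (length rs ≤_) length-ws (steinitz ws rs-ind (All.map R⊆ws rs⊆R))
      where
      n = length (us ++ ss)
      a = lookup (us ++ ss)
      ws = pick b (FS.∁ P) ++ pick b q
      -- The bound `d≤n` makes the complement of `P` have exactly `d` elements despite truncated
      -- subtraction.
      length-ws : length ws ≡ d ℕ.+ length us
      length-ws = ≡.trans (length-++ (pick b (FS.∁ P))) (≡.cong₂ ℕ._+_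
        (≡.trans (length-pick b (FS.∁ P)) (≡.trans (FSP.∣∁p∣≡n∸∣p∣ P)
          (≡.trans (≡.cong (n ℕ.∸_) ∣P∣≡) (ℕP.m∸[m∸n]≡n d≤n))))
        (≡.trans (length-pick b q) ∣q∣≡))
      in-omit : ∀ {x j} → x ∈ᵥ R → j FS.∈ P → a j ∈ˡ ss → x ∈ᵥ omitSpan b j
      in-omit {x} {j} x∈ j∈P aⱼ∈ with inverse (basis-member≉0 (lookup-isBasis a-basis) j)
      ... | a⁻¹ , aa⁻¹≈1 = matched j j∈P
              ((a⁻¹ , aa⁻¹≈1 , a j * x , product∈ (span-gen aⱼ∈) x∈
                , sym (x[yz]≈z x (trans (*-comm a⁻¹ (a j)) aa⁻¹≈1))) , R⊆B x∈)
      R⊆ws : R ⊆ᵥ span ws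
      R⊆ws {x} x∈ with IsBasis.spans b-basis (R⊆B x∈)
      ... | k , k∈ , x≈ = Subspace.resp (span ws) (sym x≈) (combination∈⟪⟫ (_∈ˡ ws) k b k∈ vanish-or-listed)
        where
        vanish-or-listed : ∀ j → k j ≈ 0# ⊎ b j ∈ˡ ws
        vanish-or-listed j with j FSP.∈? P | j FSP.∈? q
        ... | no j∉P  | _       = inj₂ (ListMembershipProperties.∈-++⁺ˡ setoid (∈-pick b (FSP.x∉p⇒x∈∁p j∉P)))
        ... | yes _   | yes j∈q = inj₂ (ListMembershipProperties.∈-++⁺ʳ setoid (pick b (FS.∁ P)) (∈-pick b j∈q))
        ... | yes j∈P | no j∉q  = inj₁ (omit-coefficient b b-basis k k∈ j
              (Subspace.resp (omitSpan b j) x≈ (in-omit x∈ j∈P (rest j∉q))))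

    -- Rado's theorem with defect, for the annihilators of the spaces aᵢ⁻¹A ∩ B in the dual of B.
    unmatched-pair : ∀ {A B n ℓ} → HasDim A n → HasDim B n → ℓ ≤ n → ¬ PartiallyMatched A B n ℓ →
      Σ[ p ∈ Transform.Pair A B ] n ℕ.+ ℓ < Transform.size A B p
    unmatched-pair {A} {B} {n} {ℓ} (a₀ , a₀-basis) (b₀ , b₀-basis) ℓ≤n ¬pm
      with em {P = ∃[ a ] (IsBasis A {n} a × ¬ (∃[ b ] (IsBasis B {n} b × BasisPartiallyMatched A B a b ℓ)))}
    ... | no none = contradiction (ℓ≤n , λ a a-basis →
            case em {P = ∃[ b ] (IsBasis B {n} b × BasisPartiallyMatched A B a b ℓ)} of λ
              { (yes found) → found ; (no ¬found) → contradiction (a , a-basis , ¬found) none }) ¬pm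
    ... | yes (a , a-basis , ¬matched) = record
            { ts = ts ; rs = rs
            ; ts-ind = independent-pick a q (ListBasis.independent (toListBasis a-basis))
            ; rs-ind = independent-pick (b s) outer (ListBasis.independent (toListBasis s-basis))
            ; ts⊆A = All-pick a q (λ _ → IsBasis.members a-basis _)
            ; rs⊆B = All-pick (b s) outer (λ _ → b∈ s _)
            ; product∈ = λ t∈ r∈ → proj₂ (rs⊆ r∈ t∈)
            } , n+ℓ<size
      where
      V : Fin n → Subspace K
      V i = a i ⁻¹·ˢ A ∩ B
      open Rado B V (λ i → proj₁)
      open Matching
      initial : Matching
      initial = record
        { b = b₀ ; b∈ = IsBasis.members b₀-basis
        ; spans = ListBasis.spanning (toListBasis b₀-basis)
        ; P = FS.⊥ ; matched = λ i∈⊥ → contradiction i∈⊥ FSP.∉⊥ }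
      s : Matching
      s = proj₁ (maximal-matching initial)
      open Violator s (proj₂ (maximal-matching initial))
      s-basis : IsBasis B (b s)
      s-basis = spanning-basis (b₀ , b₀-basis) (b s) (b∈ s) (spans s)
      q = proj₁ (comprehension em J)
      q⇒J : ∀ {i} → i FS.∈ q → J i
      q⇒J = proj₁ (proj₂ (comprehension em J))
      J⇒q : ∀ {i} → J i → i FS.∈ q
      J⇒q = proj₂ (proj₂ (comprehension em J))
      outer = FS.∁ (P s FS.∩ q)
      ts = pick a q
      rs = pick (b s) outer
      -- A matching with defect `ℓ` asks for exactly `n ∸ ℓ` labels, so a larger `P s` is cut down
      -- before the contradiction.
      small : FS.∣ P s ∣ < n ℕ.∸ ℓ
      small with FS.∣ P s ∣ ℕP.<? n ℕ.∸ ℓ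
      ... | yes P<  = P<
      ... | no P≮ with shrink (P s) (ℕP.≮⇒≥ P≮)
      ...   | p , p⊆P , ∣p∣≡ = contradiction (b s , s-basis , p , ∣p∣≡ ,
                λ { i i∈p ((a⁻¹ , aa⁻¹≈1 , v , v∈ , x≈) , x∈B) → matched s (p⊆P i∈p)
                  (x∈B , Subspace.resp A (sym (trans (*-congˡ x≈) (x[yz]≈z v aa⁻¹≈1))) v∈) }) ¬matched
      outer∈ : ∀ {u k} → u FS.∈ q → k FS.∈ outer → b s k ∈ᵥ V u
      outer∈ u∈ k∈ = outer∈J (q⇒J u∈) λ { (k∈P , Jk) → FSP.x∈∁p⇒x∉p k∈ (FSP.x∈p∩q⁺ (k∈P , J⇒q Jk)) }
      -- Linearity is used one factor at a time: for each `u` in `q` the span of `rs` lies in `V u`;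
      -- then for fixed `r` the `t` in `A` with `r * t` in `A` form a subspace containing `ts`.
      rs⊆ : ∀ {t r} → r ∈ᵥ span rs → t ∈ᵥ span ts → t ∈ᵥ A × t * r ∈ᵥ A
      rs⊆ {t} {r} r∈ t∈ with span-least (r ⁻¹·ˢ A ∩ A) (All-pick a q λ {u} u∈ → IsBasis.members a-basis u
          , Subspace.resp A (*-comm (a u) r)
              (proj₂ (span-least (V u) (All-pick (b s) outer (outer∈ u∈)) r∈))) t∈
      ... | t∈A , rt∈A = t∈A , Subspace.resp A (*-comm r t) rt∈A
      n+ℓ<size : n ℕ.+ ℓ < length ts ℕ.+ length rs
      n+ℓ<size = ≡.subst₂ (λ x y → n ℕ.+ ℓ < x ℕ.+ y) (≡.sym (length-pick a q))
        (≡.sym (≡.trans (length-pick (b s) outer) (FSP.∣∁p∣≡n∸∣p∣ (P s FS.∩ q))))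
        (ℕP.+-cancelˡ-< (FS.∣ P s ∣ ℕ.+ m) (n ℕ.+ ℓ) _ count)
        where
        m = FS.∣ P s FS.∩ q ∣
        open ℕP.≤-Reasoning
        open ℕSolver.+-*-Solver
        -- Adding `∣ P s ∣ + m` to both sides lets inclusion-exclusion apply without subtraction.
        -- The labels outside `P s` are in `J` because `s` itself is reachable.
        count : FS.∣ P s ∣ ℕ.+ m ℕ.+ (n ℕ.+ ℓ) < FS.∣ P s ∣ ℕ.+ m ℕ.+ (FS.∣ q ∣ ℕ.+ (n ℕ.∸ m))
        count = begin-strict
          FS.∣ P s ∣ ℕ.+ m ℕ.+ (n ℕ.+ ℓ)
            ≡⟨ solve 4 (λ p m n l → p :+ m :+ (n :+ l) := n :+ m :+ (p :+ l)) ≡.refl FS.∣ P s ∣ m n ℓ ⟩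
          n ℕ.+ m ℕ.+ (FS.∣ P s ∣ ℕ.+ ℓ)
            <⟨ ℕP.+-monoʳ-< (n ℕ.+ m) (m<n∸o⇒m+o<n n ℓ small) ⟩
          n ℕ.+ m ℕ.+ n
            ≡⟨ ≡.cong₂ ℕ._+_ (∣∩∣-cover (P s) q (λ i∉ → J⇒q (s , origin , i∉)))
                 (≡.sym (ℕP.m+[n∸m]≡n (FSP.∣p∣≤n (P s FS.∩ q)))) ⟩
          FS.∣ P s ∣ ℕ.+ FS.∣ q ∣ ℕ.+ (m ℕ.+ (n ℕ.∸ m))
            ≡⟨ solve 4 (λ p m q r → p :+ q :+ (m :+ r) := p :+ m :+ (q :+ r))
                 ≡.refl FS.∣ P s ∣ m FS.∣ q ∣ (n ℕ.∸ m) ⟩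
          FS.∣ P s ∣ ℕ.+ m ℕ.+ (FS.∣ q ∣ ℕ.+ (n ℕ.∸ m))
            ∎

  -- Vector spaces over `K(R)`, and the two implications.

  module Characterization (K : Subfield L) where

    open Linear K

    module _ (ts rs : List Carrier) (ts-ind : Independent ts)
             (stable : ∀ {t r} → t ∈ᵥ span ts → r ∈ᵥ span rs → t * r ∈ᵥ span ts) where

      private
        T = span ts
        F = K ⟮ Subspace.set (span rs) ⟯
        module LF = Linear F

      -- Multiplication by x ≠ 0 is injective on the finite-dimensional T, hence onto, so x⁻¹T ⊆ T.
      adjoin-stable : ∀ {x} → x ∈ Subfield.set F → ∀ {t} → t ∈ᵥ T → x * t ∈ᵥ T
      adjoin-stable (base k∈)        t∈ = Subspace.*-closed T k∈ t∈
      adjoin-stable (gen r∈)         t∈ = Subspace.resp T (*-comm _ _) (stable t∈ r∈)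
      adjoin-stable (≈-closed x≈y x) t∈ = Subspace.resp T (*-congʳ x≈y) (adjoin-stable x t∈)
      adjoin-stable (add x y)        t∈ = Subspace.resp T (sym (distribʳ _ _ _))
                                            (Subspace.+-closed T (adjoin-stable x t∈) (adjoin-stable y t∈))
      adjoin-stable (neg x)          t∈ = Subspace.resp T (-‿distribˡ-* _ _) (neg∈ T (adjoin-stable x t∈))
      adjoin-stable (mul x y)        t∈ = Subspace.resp T (sym (*-assoc _ _ _))
                                            (adjoin-stable x (adjoin-stable y t∈))
      adjoin-stable (inv {x} {y} x∈ xy≈1) {t} t∈ = Subspace.resp T (sym yt≈t′) t′∈
        where
        x≉0 : ¬ (x ≈ 0#)
        x≉0 x≈0 = 1≉0 (trans (sym xy≈1) (trans (*-congʳ x≈0) (zeroˡ y)))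
        onto : T ⊆ᵥ x ·ˢ T
        onto t∈ = span-map x ts (long-spans {T} (λ u∈ → u∈) (independent-map x≉0 ts-ind)
          (AllP.map⁺ (All.map (adjoin-stable x∈) (span-members ts)))
          (ℕP.≤-reflexive (≡.sym (length-map (x *_) ts))) t∈)
        t′ = proj₁ (onto t∈)
        t′∈ : t′ ∈ᵥ T
        t′∈ = proj₁ (proj₂ (onto t∈))
        yt≈t′ : y * t ≈ t′
        yt≈t′ = trans (*-congˡ (proj₂ (proj₂ (onto t∈)))) (x[yz]≈z t′ (trans (*-comm y x) xy≈1))

      -- By `adjoin-stable`, `T` is a vector space over `F`. Independence over `F` implies
      -- independence over `K`, so `ts` bounds the independent lists over `F` too; an `F`-basis
      -- exists and its lines over `F` are the summands.
      stable⇒⨁ : Σ[ m ∈ ℕ ] Σ[ a ∈ Vector Carrier m ] ((∀ i → a i ∈ᵥ T) × T ≐⨁ (λ i → a i ∙ F))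
      stable⇒⨁ = length as , lookup as , IsBasis.members as-basis , record
        { contains    = λ u u∈ → sum∈ T (λ i → case u∈ i of λ
            { (w , w∈ , uᵢ≈) → Subspace.resp T (sym (trans uᵢ≈ (*-comm _ w)))
                (adjoin-stable w∈ (IsBasis.members as-basis i)) })
        ; spans       = λ x∈ → case IsBasis.spans as-basis x∈ of λ
            { (k , k∈ , x≈) → (λ i → k i * lookup as i) , (λ i → k i , k∈ i , *-comm _ _) , x≈ }
        ; independent = λ u u∈ Σ≈0 i → trans (proj₂ (proj₂ (u∈ i))) (trans (*-congˡ
            (IsBasis.independent as-basis (proj₁ ∘ u∈) (λ j → proj₁ (proj₂ (u∈ j)))
              (trans (sum-cong-≋ (λ j → trans (*-comm _ _) (sym (proj₂ (proj₂ (u∈ j)))))) Σ≈0) i)) (zeroʳ _))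
        }
        where
        T-over-F : Subspace F
        T-over-F = record { set = Subspace.set T ; resp = Subspace.resp T ; 0∈ = Subspace.0∈ T
                          ; +-closed = Subspace.+-closed T ; *-closed = λ k∈ x∈ → adjoin-stable k∈ x∈ }
        restrict : ∀ {vs} → LF.Independent vs → Independent vs
        restrict LF.[]          = []
        restrict (v∉ LF.∷ ind) =
          (λ { (m , w , w∈ , k , k∈ , x≈) → v∉ (m , w , w∈ , k , base ∘ k∈ , x≈) }) ∷ restrict ind
        extension = LF.extend {T-over-F} (λ ind vs∈ → steinitz ts (restrict ind) vs∈) LF.[] []
        as = proj₁ extension ++ []
        as-basis : IsBasis T-over-F (lookup as)
        as-basis = LF.lookup-isBasis (proj₂ extension)

    Decomposition : Subspace K → Subspace K → ℕ → Set _
    Decomposition A B ℓ = Σ[ R ∈ Subspace K ] (R ⊆ᵥ B × IsNonzero R ×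
      Σ[ S ∈ Subspace K ] Σ[ Y ∈ Subspace K ] Σ[ Z ∈ Subspace K ]
        (A ≐ S ⊕ Y × B ≐ R ⊕ Z × (dim Y <dim R - ℓ) ×
          Σ[ m ∈ ℕ ] Σ[ a ∈ Vector Carrier m ]
            ((∀ i → a i ∈ᵥ S) × S ≐⨁ (λ i → a i ∙ (K ⟮ Subspace.set R ⟯)))))

    unmatched⇒decomposition : ∀ {A B n ℓ} → HasDim A n → HasDim B n → ℓ ≤ n → ¬ PartiallyMatched A B n ℓ →
                              Decomposition A B ℓ
    unmatched⇒decomposition {A} {B} {n} {ℓ} dimA@(a , a-basis) dimB@(b , b-basis) ℓ≤n ¬pm
      with unmatched-pair dimA dimB ℓ≤n ¬pm
    ... | p₀ , large₀ with Transform.stabilize A B p₀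
    ...   | p , size≡ , stable
      with extend (spanned-bounded {A} (ListBasis.spanning (toListBasis a-basis)))
             (Transform.Pair.ts-ind p) (Transform.Pair.ts⊆A p)
         | extend (spanned-bounded {B} (ListBasis.spanning (toListBasis b-basis)))
             (Transform.Pair.rs-ind p) (Transform.Pair.rs⊆B p)
    ...   | us , A-basis | zs , B-basis =
      span rs , span-least B rs⊆B , nonzero rs-ind (ℕP.≤-<-trans z≤n us+ℓ<rs) , span ts , span us , span zs
        , basis-⊕ A-basis , basis-⊕ B-basis
        , (length us , length rs
            , span-hasDim (independent-++ˡ us (ListBasis.independent A-basis)) , span-hasDim rs-ind
            , ℕP.m+n≤o⇒m≤o∸n _ us+ℓ<rs)
        , stable⇒⨁ ts rs ts-ind stable
      where
      open Transform.Pair p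
      nonzero : ∀ {vs} → Independent vs → 0 < length vs → IsNonzero (span vs)
      nonzero {v ∷ vs} (v∉ ∷ _) _ = v , span-gen (here refl) ,
        λ v≈0 → v∉ (Subspace.resp (span vs) (sym v≈0) (Subspace.0∈ (span vs)))
      us+ts≡n : length us ℕ.+ length ts ≡ n
      us+ts≡n = ≡.trans (≡.sym (length-++ us))
        (≡.trans (length-basis A-basis (toListBasis a-basis)) (length-tabulate a))
      -- Cancelling `length ts` from the excess over `n + ℓ` leaves the required gap, which also
      -- shows that `R` is nonzero.
      us+ℓ<rs : length us ℕ.+ ℓ < length rs
      us+ℓ<rs = ℕP.+-cancelˡ-< (length ts) _ _ (begin-strict
        length ts ℕ.+ (length us ℕ.+ ℓ)   ≡⟨ ℕP.+-assoc (length ts) _ ℓ ⟨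
        length ts ℕ.+ length us ℕ.+ ℓ     ≡⟨ ≡.cong (ℕ._+ ℓ) (≡.trans (ℕP.+-comm (length ts) _) us+ts≡n) ⟩
        n ℕ.+ ℓ                           <⟨ large₀ ⟩
        Transform.size A B p₀             ≡⟨ size≡ ⟨
        length ts ℕ.+ length rs           ∎)
        where
        open ℕP.≤-Reasoning

    -- A matching with defect `d` would bound `dim R` by `d` plus the codimension of `S` in `A`,
    -- hence by `ℓ + dim Y`. Allowing every `d ≤ ℓ` lets `d` be the deficiency itself.
    decomposition⇒unmatched : ∀ {A B n ℓ d} → HasDim A n → Decomposition A B ℓ → d ≤ ℓ →
                              ¬ PartiallyMatched A B n d
    decomposition⇒unmatched {A} {B} {n} {ℓ} {d} (a , a-basis)
      (R , R⊆B , _ , S , Y , _ , A≐S⊕Y , _ , (y , r , (yv , y-basis) , (rv , r-basis) , y<r∸ℓ)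
        , m , c , _ , S≐⨁) d≤ℓ pm
      = contradiction r≤d+us (ℕP.<⇒≱ (begin-strict
          d ℕ.+ length us   ≤⟨ ℕP.+-mono-≤ d≤ℓ us≤y ⟩
          ℓ ℕ.+ y           ≡⟨ ℕP.+-comm ℓ y ⟩
          y ℕ.+ ℓ           <⟨ m<n∸o⇒m+o<n r ℓ y<r∸ℓ ⟩
          r                 ∎))
      where
      open ℕP.≤-Reasoning
      module A = _≐_⊕_ A≐S⊕Y
      module S = _≐⨁_ S≐⨁
      a-list : ListBasis A (tabulate a)
      a-list = toListBasis a-basis
      y-list : ListBasis Y (tabulate yv)
      y-list = toListBasis y-basis
      r-list : ListBasis R (tabulate rv)
      r-list = toListBasis r-basis
      S⊆A : S ⊆ᵥ A
      S⊆A s∈ = Subspace.resp A (+-identityʳ _) (A.contains s∈ (Subspace.0∈ Y))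
      S-extension = extend {S} (spanned-bounded {S} (λ s∈ → ListBasis.spanning a-list (S⊆A s∈))) [] []
      ss = proj₁ S-extension ++ []
      S-basis : ListBasis S ss
      S-basis = proj₂ S-extension
      A-extension = extend (spanned-bounded {A} (ListBasis.spanning a-list))
        (ListBasis.independent S-basis) (All.map S⊆A (ListBasis.members S-basis))
      us = proj₁ A-extension
      A-basis : ListBasis A (us ++ ss)
      A-basis = proj₂ A-extension
      A⊆ : A ⊆ᵥ span (tabulate yv ++ ss)
      A⊆ x∈ with A.spans x∈
      ... | s , y₀ , s∈ , y₀∈ , x≈ = Subspace.resp W (sym x≈) (Subspace.+-closed W
              (span-++ʳ (tabulate yv) (ListBasis.spanning S-basis s∈))
              (span-++ˡ (tabulate yv) (ListBasis.spanning y-list y₀∈)))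
        where W = span (tabulate yv ++ ss)
      -- `A` is spanned by bases of `Y` and `S`, so completing `ss` to a basis of `A` adds at most
      -- `y` vectors.
      us≤y : length us ≤ y
      us≤y = ℕP.+-cancelʳ-≤ (length ss) _ _ (begin
        length us ℕ.+ length ss             ≡⟨ length-++ us ⟨
        length (us ++ ss)                   ≤⟨ spanned-bounded {A} A⊆
                                                 (ListBasis.independent A-basis) (ListBasis.members A-basis) ⟩
        length (tabulate yv ++ ss)          ≡⟨ length-++ (tabulate yv) ⟩
        length (tabulate yv) ℕ.+ length ss  ≡⟨ ≡.cong (ℕ._+ length ss) (length-tabulate yv) ⟩
        y ℕ.+ length ss                     ∎)
      -- Each summand is a multiple of `K(R)`, which contains `x` and is closed under products.
      S-stable : ∀ {s x} → s ∈ᵥ S → x ∈ᵥ R → s * x ∈ᵥ S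
      S-stable {s} {x} s∈ x∈ with S.spans s∈
      ... | u , u∈ , s≈ = Subspace.resp S (sym (trans (*-congʳ s≈) (*-distribʳ-sum x u)))
              (S.contains (λ i → u i * x) (λ i → case u∈ i of λ
                { (w , w∈ , uᵢ≈) → w * x , mul w∈ (gen x∈) , trans (*-congʳ uᵢ≈) (*-assoc _ w x) }))
      r≤d+us : r ≤ d ℕ.+ length us
      r≤d+us = ≡.subst (_≤ d ℕ.+ length us) (length-tabulate rv)
        (matched-bound {R = R} {us} A-basis R⊆B
          (λ s∈ x∈ → S⊆A (S-stable (span-least S (ListBasis.members S-basis) s∈) x∈))
          (ListBasis.independent r-list) (ListBasis.members r-list)
          (≡.subst (λ l → PartiallyMatched A B l d)
            (≡.trans (≡.sym (length-tabulate a)) (length-basis a-list A-basis)) pm))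

theorem4p1 : ∀ {c ℓ₁ ℓ₂} (em : ∀ {a} → ExcludedMiddle a)
    (L : HeytingField c ℓ₁ ℓ₂) (K : Subfield L) → IsProper K →
    (A B : Subspace K) (n : ℕ) → 0 < n →
    (dimA : HasDim A n) (dimB : HasDim B n) →
    ¬ (HeytingField.1# L ∈ᵥ B) →
    (ℓ : ℕ) →
    (δ em A B dimA dimB > ℓ)
    ⇔
    (Σ[ R ∈ Subspace K ] (R ⊆ᵥ B × IsNonzero R ×
    Σ[ S ∈ Subspace K ] Σ[ Y ∈ Subspace K ] Σ[ Z ∈ Subspace K ]
    (A ≐ S ⊕ Y × B ≐ R ⊕ Z × (dim Y <dim R - ℓ) ×
    Σ[ m ∈ ℕ ] Σ[ a ∈ Vector (HeytingField.Carrier L) m ]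
    ((∀ i → a i ∈ᵥ S) × S ≐⨁ (λ i → a i ∙ (K ⟮ Subspace.set R ⟯))))))
theorem4p1 em L K _ A B n _ dimA dimB _ ℓ with deficiency em A B dimA dimB
... | d , pm , d-least = mk⇔
  -- Defects are at most `n`, so `ℓ` below the deficiency is an admissible defect, and minimality
  -- excludes it.
  (λ ℓ<d → unmatched⇒decomposition dimA dimB (ℕP.≤-trans (ℕP.<⇒≤ ℓ<d) (proj₁ pm))
    (λ pmℓ → ℕP.<⇒≱ ℓ<d (d-least ℓ pmℓ)))
  (λ dec → ℕP.≰⇒> λ d≤ℓ → decomposition⇒unmatched dimA dec d≤ℓ pm)
  where
  open Field.Characterization em L K
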